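{- Let $q>2$ be a prime power, and let $\mathcal{SC}\subseteq\mathbb Z[\mathrm{SL}_2(\mathbb F_q)]$ be the ring of support-classes defined below. Then the $\mathbb Q$-algebra $\mathcal{SC}_{\mathbb Q}=\mathcal{SC}\otimes_{\mathbb Z}\mathbb Q$ is a semisimple algebra isomorphic to $\mathbb Q\oplus\mathbb Q\oplus\mathbb Q\oplus M_2(\mathbb Q)$.
   Context: For subsets $\mathcal A,\mathcal B,\mathcal C,\mathcal D\subseteq \mathbb F_q$, write $\left(\begin{array}{cc}\mathcal A&\mathcal B\\\mathcal C&\mathcal D\end{array}\right)$ for the element $\sum \left(\begin{array}{cc}a&b\\c&d\end{array}\right)$ of $\mathbb Z[\mathrm{SL}_2(\mathbb F_q)]$, the sum over all $(a,b,c,d)\in\mathcal A\times\mathcal B\times\mathcal C\times\mathcal D$ with $ad-bc=1$. Write $0$ for $\{0\}$ and $\mathbb F_q^*=\mathbb F_q\setminus\{0\}$. Let $A=\left(\begin{array}{cc}\mathbb F_q^*&0\\0&\mathbb F_q^*\end{array}\right)$, $B=\left(\begin{array}{cc}0&\mathbb F_q^*\\\mathbb F_q^*&0\end{array}\right)$, $C=\left(\begin{array}{cc}\mathbb F_q^*&\mathbb F_q^*\\\mathbb F_q^*&\mathbb F_q^*\end{array}\right)$, $D_+=\left(\begin{array}{cc}\mathbb F_q^*&\mathbb F_q^*\\0&\mathbb F_q^*\end{array}\right)$, $D_-=\left(\begin{array}{cc}\mathbb F_q^*&0\\\mathbb F_q^*&\mathbb F_q^*\end{array}\right)$, $E_+=\left(\begin{array}{cc}\mathbb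 F_q^*&\mathbb F_q^*\\\mathbb F_q^*&0\end{array}\right)$, $E_-=\left(\begin{array}{cc}0&\mathbb F_q^*\\\mathbb F_q^*&\mathbb F_q^*\end{array}\right)$. The ring of support-classes is $\mathcal{SC}=\mathbb Z A+\mathbb Z B+\mathbb ZC+\mathbb ZD_++\mathbb ZD_-+\mathbb Z E_++\mathbb Z E_-$, a free $\mathbb Z$-module of rank $7$ which is closed under the multiplication of $\mathbb Z[\mathrm{SL}_2(\mathbb F_q)]$; $\mathcal{SC}_{\mathbb Q}$ is the resulting $7$-dimensional $\mathbb Q$-subalgebra of $\mathbb Q[\mathrm{SL}_2(\mathbb F_q)]$ (its identity element is $\frac{1}{q-1}A$). -}

module Defs where

open import Data.Nat using (ℕ; _∸_)
open import Data.Fin using (Fin; zero; suc)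
open import Data.Fin.Properties using () renaming (_≟_ to _≟ᶠ_)
open import Data.Bool using (Bool; not; true; false; _∧_; if_then_else_)
open import Data.Product using (Σ; _×_; _,_; proj₁; proj₂)
open import Data.List using (List; []; _∷_; map; foldr; concatMap; allFin)
open import Data.Integer using (+_)
open import Data.Rational using (ℚ; _+_; _*_; 0ℚ; 1ℚ; _/_)
open import Relation.Nullary using (¬_; Dec; yes; no)
open import Relation.Nullary.Decidable using (⌊_⌋)
open import Relation.Binary.PropositionalEquality using (_≡_; _≢_; cong; refl; trans; sym)
open import Relation.Binary.Definitions using (DecidableEquality)
open import Function.Bundles using (_↔_; Inverse)
open import Algebra.Structures using (IsCommutativeRing)

record FiniteField : Set₁ where
  infixl 7 _·_
  infixl 6 _⊕_
  field
    Carrier : Set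
    _⊕_     : Carrier → Carrier → Carrier
    _·_     : Carrier → Carrier → Carrier
    ⊝_      : Carrier → Carrier
    0#      : Carrier
    1#      : Carrier
    isCommutativeRing : IsCommutativeRing _≡_ _⊕_ _·_ ⊝_ 0# 1#
    0≢1     : 0# ≢ 1#
    inverse : ∀ x → x ≢ 0# → Σ Carrier (λ y → x · y ≡ 1#)
    size    : ℕ
    enum    : Carrier ↔ Fin size

module SupportClasses (F : FiniteField) where
  open FiniteField F

  _≟_ : DecidableEquality Carrier
  x ≟ y with Inverse.to enum x ≟ᶠ Inverse.to enum y
  ... | yes p = yes (trans (sym (Inverse.strictlyInverseʳ enum x))
                    (trans (cong (Inverse.from enum) p) (Inverse.strictlyInverseʳ enum y)))
  ... | no ¬p = no (λ e → ¬p (cong (Inverse.to enum) e))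

  elemsF : List Carrier
  elemsF = map (Inverse.from enum) (allFin size)

  -- 2×2 matrices (a , b , c , d) = ( a b ; c d )
  Mat : Set
  Mat = Carrier × Carrier × Carrier × Carrier

  det : Mat → Carrier
  det (a , b , c , d) = a · d ⊕ ⊝ (b · c)

  _⊗_ : Mat → Mat → Mat
  (a , b , c , d) ⊗ (a' , b' , c' , d') =
    (a · a' ⊕ b · c' , a · b' ⊕ b · d' , c · a' ⊕ d · c' , c · b' ⊕ d · d')

  _≟M_ : DecidableEquality Mat
  (a , b , c , d) ≟M (a' , b' , c' , d') with a ≟ a' | b ≟ b' | c ≟ c' | d ≟ d'
  ... | yes refl | yes refl | yes refl | yes refl = yes refl
  ... | no ¬p | _ | _ | _ = no (λ { refl → ¬p refl })
  ... | yes _ | no ¬p | _ | _ = no (λ { refl → ¬p refl })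
  ... | yes _ | yes _ | no ¬p | _ = no (λ { refl → ¬p refl })
  ... | yes _ | yes _ | yes _ | no ¬p = no (λ { refl → ¬p refl })

  SL₂ : Set
  SL₂ = Σ Mat (λ m → det m ≡ 1#)

  allMat : List Mat
  allMat = concatMap (λ a → concatMap (λ b → concatMap (λ c → map (λ d → (a , b , c , d)) elemsF) elemsF) elemsF) elemsF

  elemsSL : List SL₂
  elemsSL = foldr step [] allMat
    where
    step : Mat → List SL₂ → List SL₂
    step m acc with det m ≟ 1#
    ... | yes p = (m , p) ∷ acc
    ... | no _  = acc

  sumℚ : List ℚ → ℚ
  sumℚ = foldr _+_ 0ℚ

  -- the group algebra ℚ[SL₂(F_q)]: ℚ-valued functions on the (finite) group
  QG : Set
  QG = SL₂ → ℚ

  _+G_ : QG → QG → QG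
  (f +G g) x = f x + g x

  _•G_ : ℚ → QG → QG
  (r •G f) x = r * f x

  _⋆_ : QG → QG → QG
  (f ⋆ g) m = sumℚ (concatMap (λ x → map (λ y →
                 if ⌊ (proj₁ x ⊗ proj₁ y) ≟M proj₁ m ⌋ then f x * g y else 0ℚ) elemsSL) elemsSL)

  data Kind : Set where
    Z NZ : Kind

  inKind : Kind → Carrier → Bool
  inKind Z  x = ⌊ x ≟ 0# ⌋
  inKind NZ x = not ⌊ x ≟ 0# ⌋

  -- the element ( 𝒜 ℬ ; 𝒞 𝒟 ) of ℤ[SL₂] ⊆ ℚ[SL₂] (indicator of its support)
  supp : Kind → Kind → Kind → Kind → QG
  supp kA kB kC kD ((a , b , c , d) , _) =
    if inKind kA a ∧ inKind kB b ∧ inKind kC c ∧ inKind kD d then 1ℚ else 0ℚ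

  A B C D₊ D₋ E₊ E₋ : QG
  A  = supp NZ Z  Z  NZ
  B  = supp Z  NZ NZ Z
  C  = supp NZ NZ NZ NZ
  D₊ = supp NZ NZ Z  NZ
  D₋ = supp NZ Z  NZ NZ
  E₊ = supp NZ NZ NZ Z
  E₋ = supp Z  NZ NZ NZ

  basis : Fin 7 → QG
  basis zero = A
  basis (suc zero) = B
  basis (suc (suc zero)) = C
  basis (suc (suc (suc zero))) = D₊
  basis (suc (suc (suc (suc zero)))) = D₋
  basis (suc (suc (suc (suc (suc zero))))) = E₊
  basis (suc (suc (suc (suc (suc (suc zero)))))) = E₋

  comb : (Fin 7 → ℚ) → QG
  comb c x = sumℚ (map (λ i → c i * basis i x) (allFin 7))

  -- membership in 𝒮𝒞_ℚ = ℚ-span of the basis inside ℚ[SL₂(F_q)]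
  In𝒮𝒞 : QG → Set
  In𝒮𝒞 f = Σ (Fin 7 → ℚ) (λ c → ∀ x → comb c x ≡ f x)

  -- identity element of 𝒮𝒞_ℚ : (1/(q-1)) A ; stated as (q-1) · e = A
  qm1 : ℚ
  qm1 = (+ (size ∸ 1)) / 1

M₂ℚ : Set
M₂ℚ = ℚ × ℚ × ℚ × ℚ

_*M_ : M₂ℚ → M₂ℚ → M₂ℚ
(a , b , c , d) *M (a' , b' , c' , d') =
  (a * a' + b * c' , a * b' + b * d' , c * a' + d * c' , c * b' + d * d')

T : Set
T = ℚ × ℚ × ℚ × M₂ℚ

_+T_ : T → T → T
(x , y , z , (a , b , c , d)) +T (x' , y' , z' , (a' , b' , c' , d')) =
  (x + x' , y + y' , z + z' , (a + a' , b + b' , c + c' , d + d'))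

_•T_ : ℚ → T → T
r •T (x , y , z , (a , b , c , d)) = (r * x , r * y , r * z , (r * a , r * b , r * c , r * d))

_*T_ : T → T → T
(x , y , z , m) *T (x' , y' , z' , m') = (x * x' , y * y' , z * z' , m *M m')

1T : T
1T = (1ℚ , 1ℚ , 1ℚ , (1ℚ , 0ℚ , 0ℚ , 1ℚ))

-- "𝒮𝒞_ℚ ≅ ℚ ⊕ ℚ ⊕ ℚ ⊕ M₂(ℚ) as ℚ-algebras", expressed as a ℚ-algebra
-- embedding ψ : T → ℚ[SL₂(F_q)] whose image is exactly 𝒮𝒞_ℚ.

module _ (F : FiniteField) where
  open SupportClasses F

  record IsoToSC (ψ : T → QG) : Set where
    field
      additive       : ∀ u v x → ψ (u +T v) x ≡ (ψ u +G ψ v) x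
      homogeneous    : ∀ r u x → ψ (r •T u) x ≡ (r •G ψ u) x
      multiplicative : ∀ u v x → ψ (u *T v) x ≡ (ψ u ⋆ ψ v) x
      unital         : ∀ x → qm1 * ψ 1T x ≡ A x
      injective      : ∀ u v → (∀ x → ψ u x ≡ ψ v x) → u ≡ v
      into𝒮𝒞         : ∀ u → In𝒮𝒞 (ψ u)
      onto𝒮𝒞         : ∀ c → Σ T (λ u → ∀ x → ψ u x ≡ comb c x)

{-# OPTIONS --safe #-}
-- Let e₁, e₂ be the coordinate lines and Pᵢⱼ the indicator of {x : x eⱼ = eᵢ}, so that P₁₁, P₁₂, P₂₁, P₂₂ are the
-- supports of c = 0, d = 0, a = 0, b = 0. Together with A = P₁₁P₂₂, B = P₂₁P₁₂ and the indicator G of the whole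
-- group they span 𝒮𝒞. With n = q − 1 one has A ⋆ f = n f, B ⋆ f = n · (f with rows swapped), G ⋆ f = |f| G and
--   Pᵢⱼ ⋆ Pⱼₗ = n q Pᵢₗ,   Pᵢⱼ ⋆ Pₖₗ = n (G − Pᵢₗ) for j ≠ k,
-- because x ∈ SL₂ has prescribed column directions in n ways if these are distinct and in no way otherwise.
-- Modulo G the Pᵢⱼ multiply like matrix units twisted by M = n (q −1; −1 q), so Y ↦ Y M maps them onto M₂(ℚ).
-- The three remaining characters are the trivial one and the two given by A ↦ n, B ↦ ± n that kill G and the Pᵢⱼ.

module Submission where

-- The link between convolution and counting is that x⁻¹m maps eⱼ into the line of eᵢ exactly when
-- the j-th column of m is parallel to the i-th column of x. In (f ⋆ g)(m) = ∑ f(x) g(x⁻¹m) both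
-- factors therefore see x only through the directions of its columns, and every product becomes a
-- count that is polynomial in n and in indicators of parallelism. What remains are polynomial
-- identities between coordinate vectors of length 7, with the zero pattern of m as four further
-- variables. The map `ψ` runs backwards: `χ⁻¹` turns a target element into coordinates, which are
-- then evaluated at the zero pattern. Inverting `χ` takes four denominators: n and q + 1 because
-- det M = n³(q + 1), also q because the trivial character of G is nq(q + 1), and 2 to separate the
-- characters B ↦ ± n. For q = 2 the class C is empty and the seven functions are dependent, so q >
-- 2 is what makes `ψ` injective.

open import Algebra.Bundles using (CommutativeRing)

-- Ring solver with coefficients in ℤ: over an abstract ring the solver cannot decide that 1 − 1 vanishes if the
-- coefficients are taken from the ring itself.
module IntegerCoefficients {c ℓ} (R : CommutativeRing c ℓ) where
  open CommutativeRing R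
  open import Algebra.Properties.Ring ring using (-0#≈0#; -‿distribˡ-*; -‿distribʳ-*; -‿involutive)
  open import Algebra.Properties.AbelianGroup +-abelianGroup using (⁻¹-∙-comm)
  open import Algebra.Properties.Semiring.Mult.TCOptimised semiring
    using (1+×; ×-homo-+; ×1-homo-*) renaming (_×_ to _×ₙ_)
  open import Algebra.Solver.Ring.AlmostCommutativeRing
    using (fromCommutativeRing; _-Raw-AlmostCommutative⟶_)
  open import Relation.Binary.Reasoning.Setoid setoid
  open import Data.Nat.Base as ℕ using (ℕ; zero; suc)
  open import Data.Integer.Base as ℤ using (ℤ; +_; -[1+_]; _⊖_)
  import Data.Integer.Properties as ℤ
  open import Data.Maybe.Base using (Maybe; just; nothing)
  open import Relation.Nullary using (yes; no)
  import Relation.Binary.PropositionalEquality as ≡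

  -- With the optimised multiple, `1 ×ₙ 1#` reduces to `1#`, so the constants 0 and 1 of solver
  -- terms denote `0#` and `1#` definitionally.
  fromℤ : ℤ → Carrier
  fromℤ (+ n)    = n ×ₙ 1#
  fromℤ -[1+ n ] = - (suc n ×ₙ 1#)

  fromℤ-cong : ∀ {i j} → i ≡.≡ j → fromℤ i ≈ fromℤ j
  fromℤ-cong ≡.refl = refl

  fromℤ-neg : ∀ i → fromℤ (ℤ.- i) ≈ - fromℤ i
  fromℤ-neg (+ zero)   = sym -0#≈0#
  fromℤ-neg (+ suc n)  = refl
  fromℤ-neg -[1+ n ]   = sym (-‿involutive _)

  fromℤ-⊖ : ∀ m n → fromℤ (m ⊖ n) ≈ m ×ₙ 1# + - (n ×ₙ 1#)
  fromℤ-⊖ m       zero    = sym (trans (+-congˡ -0#≈0#) (+-identityʳ _))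
  fromℤ-⊖ zero    (suc n) = sym (+-identityˡ _)
  fromℤ-⊖ (suc m) (suc n) = begin
    fromℤ (suc m ⊖ suc n)          ≈⟨ fromℤ-cong (ℤ.[1+m]⊖[1+n]≡m⊖n m n) ⟩
    fromℤ (m ⊖ n)                  ≈⟨ fromℤ-⊖ m n ⟩
    M + - N                        ≈⟨ +-congʳ (+-identityˡ M) ⟨
    (0# + M) + - N                 ≈⟨ +-congʳ (+-congʳ (-‿inverseʳ 1#)) ⟨
    (1# + - 1# + M) + - N          ≈⟨ +-congʳ (trans (+-assoc _ _ _) (trans (+-congˡ (+-comm _ _))
                                                  (sym (+-assoc _ _ _)))) ⟩
    (1# + M + - 1#) + - N          ≈⟨ +-assoc _ _ _ ⟩
    1# + M + (- 1# + - N)          ≈⟨ +-congˡ (⁻¹-∙-comm 1# N) ⟩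
    1# + M + - (1# + N)            ≈⟨ +-cong (1+× m 1#) (-‿cong (1+× n 1#)) ⟨
    suc m ×ₙ 1# + - (suc n ×ₙ 1#)  ∎
    where
    M = m ×ₙ 1#
    N = n ×ₙ 1#

  fromℤ-+ : ∀ i j → fromℤ (i ℤ.+ j) ≈ fromℤ i + fromℤ j
  fromℤ-+ (+ m)    (+ n)    = ×-homo-+ 1# m n
  fromℤ-+ (+ m)    -[1+ n ] = fromℤ-⊖ m (suc n)
  fromℤ-+ -[1+ m ] (+ n)    = trans (fromℤ-⊖ n (suc m)) (+-comm _ _)
  fromℤ-+ -[1+ m ] -[1+ n ] = begin
    fromℤ (-[1+ m ] ℤ.+ -[1+ n ])      ≈⟨ fromℤ-cong (ℤ.neg-distrib-+ (+ suc m) (+ suc n)) ⟨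
    - ((suc m ℕ.+ suc n) ×ₙ 1#)        ≈⟨ -‿cong (×-homo-+ 1# (suc m) (suc n)) ⟩
    - (suc m ×ₙ 1# + suc n ×ₙ 1#)      ≈⟨ ⁻¹-∙-comm _ _ ⟨
    - (suc m ×ₙ 1#) + - (suc n ×ₙ 1#)  ∎

  fromℤ-+* : ∀ m j → fromℤ (+ m ℤ.* j) ≈ fromℤ (+ m) * fromℤ j
  fromℤ-+* m (+ n)    = trans (fromℤ-cong (≡.sym (ℤ.pos-* m n))) (×1-homo-* m n)
  fromℤ-+* m -[1+ n ] = begin
    fromℤ (+ m ℤ.* -[1+ n ])           ≈⟨ fromℤ-cong (ℤ.neg-distribʳ-* (+ m) (+ suc n)) ⟨
    fromℤ (ℤ.- (+ m ℤ.* + suc n))      ≈⟨ fromℤ-neg (+ m ℤ.* + suc n) ⟩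
    - fromℤ (+ m ℤ.* + suc n)          ≈⟨ -‿cong (fromℤ-+* m (+ suc n)) ⟩
    - (fromℤ (+ m) * fromℤ (+ suc n))  ≈⟨ -‿distribʳ-* _ _ ⟩
    fromℤ (+ m) * - fromℤ (+ suc n)    ∎

  fromℤ-* : ∀ i j → fromℤ (i ℤ.* j) ≈ fromℤ i * fromℤ j
  fromℤ-* (+ m)    j = fromℤ-+* m j
  fromℤ-* -[1+ m ] j = begin
    fromℤ (-[1+ m ] ℤ.* j)         ≈⟨ fromℤ-cong (ℤ.neg-distribˡ-* (+ suc m) j) ⟨
    fromℤ (ℤ.- (+ suc m ℤ.* j))    ≈⟨ fromℤ-neg (+ suc m ℤ.* j) ⟩
    - fromℤ (+ suc m ℤ.* j)        ≈⟨ -‿cong (fromℤ-+* (suc m) j) ⟩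
    - (fromℤ (+ suc m) * fromℤ j)  ≈⟨ -‿distribˡ-* _ _ ⟩
    - fromℤ (+ suc m) * fromℤ j    ∎

  homomorphism : ℤ.+-*-rawRing -Raw-AlmostCommutative⟶ fromCommutativeRing R
  homomorphism = record
    { ⟦_⟧ = fromℤ ; +-homo = fromℤ-+ ; *-homo = fromℤ-* ; -‿homo = fromℤ-neg ; 0-homo = refl ; 1-homo = refl }

  _≈?_ : ∀ i j → Maybe (fromℤ i ≈ fromℤ j)
  i ≈? j with i ℤ.≟ j
  ... | yes i≡j = just (fromℤ-cong i≡j)
  ... | no _    = nothing

  open import Algebra.Solver.Ring ℤ.+-*-rawRing (fromCommutativeRing R) homomorphism _≈?_ public

open import Defs
open import Axiom.UniquenessOfIdentityProofs using (module Decidable⇒UIP)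
open import Data.Bool.Base using (if_then_else_)
open import Data.Fin using (#_)
open import Data.Fin.Base using (Fin; zero; suc; inject≤)
open import Data.Fin.Patterns
open import Data.Fin.Properties using (inject≤-injective) renaming (_≟_ to _≟ᶠ_)
import Data.Integer.Base as ℤ
import Data.Integer.Properties as ℤ
open import Data.List.Base as List using (List; []; _∷_; map; concatMap; foldr; allFin; _++_)
open import Data.Nat using (ℕ; zero; suc; _∸_; _<_; s≤s)
open import Data.Nat.Coprimality as Coprimality using (1-coprimeTo)
open import Data.Product using (Σ; _×_; _,_; proj₁; proj₂)
open import Data.Vec.Base as Vec using (Vec; []; _∷_; lookup; tabulate)
open import Data.Vec.Properties using (lookup∘tabulate)
open import Function.Base using (_∘_)
open import Function.Bundles using (Inverse)
open import Relation.Binary.PropositionalEquality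
open import Relation.Nullary using (Dec; yes; no; ¬_; contradiction)
open import Relation.Nullary.Decidable using (⌊_⌋; ¬?; _×-dec_)

-- The algebra in the coordinates A, B, G, Pᵢⱼ

-- Every formula is evaluated both in ℚ and in the polynomials of the ring solver.
module Formulas {X : Set} (add mul : X → X → X) (neg : X → X) (0# 1# n : X) where
  infixl 6 _+_ _-_
  infixl 7 _*_

  _+_ _*_ _-_ : X → X → X
  _+_ = add
  _*_ = mul
  x - y = x + neg y

  q : X
  q = n + 1#

  dot : ∀ {k} → Vec X k → Vec X k → X
  dot []       []       = 0#
  dot (x ∷ xs) (y ∷ ys) = x * y + dot xs ys

  Point : Set
  Point = X × X × X × X

  monomials : Point → Vec X 7
  monomials (p₁₁ , p₁₂ , p₂₁ , p₂₂) =
    p₁₁ * p₂₂ ∷ p₂₁ * p₁₂ ∷ 1# ∷ p₁₁ ∷ p₁₂ ∷ p₂₁ ∷ p₂₂ ∷ []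

  -- The value of α A + β B + κ G + y₁₁ P₁₁ + y₁₂ P₁₂ + y₂₁ P₂₁ + y₂₂ P₂₂ where Pᵢⱼ takes the value pᵢⱼ.
  value : Vec X 7 → Point → X
  value v p = dot v (monomials p)

  swapRows : Point → Point
  swapRows (p₁₁ , p₁₂ , p₂₁ , p₂₂) = (p₂₁ , p₂₂ , p₁₁ , p₁₂)

  -- Sums over x ∈ SL₂ of the monomials in pₖₗ = [xₖ ∥ mₗ], where xₖ and mₗ are columns of x and of a fixed m: first
  -- all x, then those with x₁ ∥ u resp. x₂ ∥ u, for s = [m₁ ∥ u] and t = [m₂ ∥ u].
  total : Vec X 7
  total = n ∷ n ∷ n * q * (q + 1#) ∷ n * q ∷ n * q ∷ n * q ∷ n * q ∷ []

  row₁ row₂ : X → X → Vec X 7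
  row₁ s t = n * s ∷ n * t ∷ n * q ∷ s * (n * q) ∷ t * (n * q) ∷ n * (1# - s) ∷ n * (1# - t) ∷ []
  row₂ s t = n * t ∷ n * s ∷ n * q ∷ n * (1# - s) ∷ n * (1# - t) ∷ s * (n * q) ∷ t * (n * q) ∷ []

  -- The convolutions with v of A, B, G, P₁₁, P₁₂, P₂₁, P₂₂.
  convolved : Vec X 7 → Point → Vec X 7
  convolved v p@(p₁₁ , p₁₂ , p₂₁ , p₂₂) =
    n * value v p ∷ n * value v (swapRows p) ∷ dot v total ∷
    dot v (row₁ p₁₁ p₁₂) ∷ dot v (row₂ p₁₁ p₁₂) ∷ dot v (row₁ p₂₁ p₂₂) ∷ dot v (row₂ p₂₁ p₂₂) ∷ []

  -- Bilinear extension of the products of A, B, G and the Pᵢⱼ. If Y is the matrix of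
  -- Pᵢⱼ-coefficients and J the row swap, the last four entries are n(αY′ + βJY′ + α′Y + β′YJ) +
  -- YMY′. In the third entry (a + c)(c′ + d′) and (b + d)(a′ + b′) come from Pᵢⱼ ⋆ Pₖₗ with j ≠ k.
  mulV : Vec X 7 → Vec X 7 → Vec X 7
  mulV (α ∷ β ∷ κ ∷ a ∷ b ∷ c ∷ d ∷ []) (α′ ∷ β′ ∷ κ′ ∷ a′ ∷ b′ ∷ c′ ∷ d′ ∷ []) =
    n * (α * α′ + β * β′) ∷
    n * (α * β′ + β * α′) ∷
    n * ((α + β) * κ′ + κ * (α′ + β′)
      + q * ((q + 1#) * κ * κ′ + κ * (a′ + b′ + c′ + d′) + κ′ * (a + b + c + d))
      + (a + c) * (c′ + d′) + (b + d) * (a′ + b′)) ∷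
    n * (α * a′ + β * c′ + α′ * a + β′ * b + (q * a - b) * a′ + (q * b - a) * c′) ∷
    n * (α * b′ + β * d′ + α′ * b + β′ * a + (q * a - b) * b′ + (q * b - a) * d′) ∷
    n * (α * c′ + β * a′ + α′ * c + β′ * d + (q * c - d) * a′ + (q * d - c) * c′) ∷
    n * (α * d′ + β * b′ + α′ * d + β′ * c + (q * c - d) * b′ + (q * d - c) * d′) ∷ []

  Target : Set
  Target = X × X × X × (X × X × X × X)

  mulT : Target → Target → Target
  mulT (x , y , z , (a , b , c , d)) (x′ , y′ , z′ , (a′ , b′ , c′ , d′)) =
    x * x′ , y * y′ , z * z′ ,
    (a * a′ + b * c′ , a * b′ + b * d′ , c * a′ + d * c′ , c * b′ + d * d′)

  -- The first entry is the sum of all values: A and B have n elements, each Pᵢⱼ has nq, the group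
  -- nq(q + 1). The matrix part is n(αI + βJ) + YM with J the row swap, so A and B act on M₂ as nI
  -- and nJ.
  χ : Vec X 7 → Target
  χ (α ∷ β ∷ κ ∷ a ∷ b ∷ c ∷ d ∷ []) =
    n * (α + β) + n * q * ((q + 1#) * κ + (a + b + c + d)) , n * (α + β) , n * (α - β) ,
    (n * (α + (q * a - b)) , n * (β + (q * b - a)) , n * (β + (q * c - d)) , n * (α + (q * d - c)))

  -- The parameters i, j, k, h stand for the inverses of n, q, q + 1, 2.
  unmix : X → X → X → X → X → X → X × X × X × X → Vec X 7
  unmix i j k α β x (a , b , c , d) =
    let a′ = i * k * (q * (a - α) + (b - β))
        b′ = i * k * (q * (b - β) + (a - α))
        c′ = i * k * (q * (c - β) + (d - α))
        d′ = i * k * (q * (d - α) + (c - β))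
    in i * α ∷ i * β ∷ k * (i * j * (x - (α + β)) - i * (a′ + b′ + c′ + d′)) ∷
       i * a′ ∷ i * b′ ∷ i * c′ ∷ i * d′ ∷ []

  -- Half of y ± z is n times a coefficient of A or B; `unmix` receives these multiples as its α and
  -- β. It subtracts αI + βJ, divides by M, whose inverse is (q 1; 1 q) / (n · n(q + 1)) because q²
  -- - 1 = n(q + 1), and solves the trivial character for κ.
  χ⁻¹ : X → X → X → X → Target → Vec X 7
  χ⁻¹ h i j k (x , y , z , m) = unmix i j k (h * (y + z)) (h * (y - z)) x m

  addT : Target → Target → Target
  addT (x , y , z , (a , b , c , d)) (x′ , y′ , z′ , (a′ , b′ , c′ , d′)) =
    x + x′ , y + y′ , z + z′ , (a + a′ , b + b′ , c + c′ , d + d′)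

  scaleT : X → Target → Target
  scaleT r (x , y , z , (a , b , c , d)) = r * x , r * y , r * z , (r * a , r * b , r * c , r * d)

  -- In the order A, B, C, D₊, D₋, E₊, E₋.
  pattern₇ : Fin 7 → Point
  pattern₇ 0F = 1# , 0# , 0# , 1#
  pattern₇ 1F = 0# , 1# , 1# , 0#
  pattern₇ 2F = 0# , 0# , 0# , 0#
  pattern₇ 3F = 1# , 0# , 0# , 0#
  pattern₇ 4F = 0# , 0# , 0# , 1#
  pattern₇ 5F = 0# , 1# , 0# , 0#
  pattern₇ 6F = 0# , 0# , 1# , 0#

  -- Inclusion-exclusion: on C every Pᵢⱼ vanishes and only κ is left, on D₊, D₋, E₊, E₋ a single Pᵢⱼ
  -- is added, on A and B two of them and their product.
  interpolate : (Fin 7 → X) → Vec X 7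
  interpolate c =
    c 0F - c 3F - c 4F + c 2F ∷ c 1F - c 5F - c 6F + c 2F ∷ c 2F ∷
    c 3F - c 2F ∷ c 5F - c 2F ∷ c 6F - c 2F ∷ c 4F - c 2F ∷ []

open import Data.Rational using (ℚ; mkℚ; 0ℚ; 1ℚ; ½; _+_; _*_; -_; _-_; _/_; 1/_)
open import Data.Rational.Properties using
  ( +-identityˡ; +-identityʳ; +-assoc; *-zeroˡ; *-zeroʳ; *-identityˡ; *-identityʳ; *-distribˡ-+; *-comm; *-assoc
  ; *-inverseʳ; ↥p/↧p≡p; +-*-commutativeRing)
module ℚ-Solver = IntegerCoefficients +-*-commutativeRing
open ℚ-Solver using (Polynomial; con; var; prove; solve; _:=_; _:+_; _:*_; _:-_; :-_)
open ≡-Reasoning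

module P {m} = Formulas {Polynomial m} _:+_ _:*_ :-_ (con (ℤ.+ 0)) (con (ℤ.+ 1))
module Q = Formulas _+_ _*_ -_ 0ℚ 1ℚ

cong₇ : ∀ {a b c d e f g a′ b′ c′ d′ e′ f′ g′ : ℚ} → a ≡ a′ → b ≡ b′ → c ≡ c′ → d ≡ d′ → e ≡ e′ → f ≡ f′ → g ≡ g′ →
  _≡_ {A = Vec ℚ 7} (a ∷ b ∷ c ∷ d ∷ e ∷ f ∷ g ∷ []) (a′ ∷ b′ ∷ c′ ∷ d′ ∷ e′ ∷ f′ ∷ g′ ∷ [])
cong₇ refl refl refl refl refl refl refl = refl

congT : ∀ {a b c d e f g a′ b′ c′ d′ e′ f′ g′ : ℚ} → a ≡ a′ → b ≡ b′ → c ≡ c′ → d ≡ d′ → e ≡ e′ → f ≡ f′ → g ≡ g′ →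
  _≡_ {A = T} (a , b , c , (d , e , f , g)) (a′ , b′ , c′ , (d′ , e′ , f′ , g′))
congT refl refl refl refl refl refl refl = refl

-- Polynomial identities for product, characters and interpolation

module _ (n : ℚ) where
  -- Both sides agree as polynomials in the entries of p, not only at 0 and 1, so normal forms
  -- decide the identity.
  value-mulV : ∀ u v p → Q.dot n u (Q.convolved n v p) ≡ Q.value n (Q.mulV n u v) p
  value-mulV (α ∷ β ∷ κ ∷ a ∷ b ∷ c ∷ d ∷ []) (α′ ∷ β′ ∷ κ′ ∷ a′ ∷ b′ ∷ c′ ∷ d′ ∷ []) (p₁₁ , p₁₂ , p₂₁ , p₂₂) =
    prove (α ∷ β ∷ κ ∷ a ∷ b ∷ c ∷ d ∷ α′ ∷ β′ ∷ κ′ ∷ a′ ∷ b′ ∷ c′ ∷ d′ ∷ p₁₁ ∷ p₁₂ ∷ p₂₁ ∷ p₂₂ ∷ n ∷ [])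
      (P.dot N U (P.convolved N V W)) (P.value N (P.mulV N U V) W) refl
    where
    N = var (# 18)
    U = var 0F ∷ var 1F ∷ var 2F ∷ var 3F ∷ var 4F ∷ var 5F ∷ var 6F ∷ []
    V = var 7F ∷ var 8F ∷ var 9F ∷ var (# 10) ∷ var (# 11) ∷ var (# 12) ∷ var (# 13) ∷ []
    W = var (# 14) , var (# 15) , var (# 16) , var (# 17)

  -- On the matrix part this is (YM)(Y′M) = (YMY′)M together with JM = MJ.
  χ-mulV : ∀ u v → Q.χ n (Q.mulV n u v) ≡ Q.χ n u *T Q.χ n v
  χ-mulV (α ∷ β ∷ κ ∷ a ∷ b ∷ c ∷ d ∷ []) (α′ ∷ β′ ∷ κ′ ∷ a′ ∷ b′ ∷ c′ ∷ d′ ∷ []) =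
    congT
      (prove ρ (proj₁ L) (proj₁ R) refl)
      (prove ρ (proj₁ (proj₂ L)) (proj₁ (proj₂ R)) refl)
      (prove ρ (proj₁ (proj₂ (proj₂ L))) (proj₁ (proj₂ (proj₂ R))) refl)
      (prove ρ (proj₁ (proj₂ (proj₂ (proj₂ L)))) (proj₁ (proj₂ (proj₂ (proj₂ R)))) refl)
      (prove ρ (proj₁ (proj₂ (proj₂ (proj₂ (proj₂ L))))) (proj₁ (proj₂ (proj₂ (proj₂ (proj₂ R))))) refl)
      (prove ρ (proj₁ (proj₂ (proj₂ (proj₂ (proj₂ (proj₂ L)))))) (proj₁ (proj₂ (proj₂ (proj₂ (proj₂ (proj₂ R)))))) refl)
      (prove ρ (proj₂ (proj₂ (proj₂ (proj₂ (proj₂ (proj₂ L)))))) (proj₂ (proj₂ (proj₂ (proj₂ (proj₂ (proj₂ R)))))) refl)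
    where
    N = var (# 14)
    U = var 0F ∷ var 1F ∷ var 2F ∷ var 3F ∷ var 4F ∷ var 5F ∷ var 6F ∷ []
    V = var 7F ∷ var 8F ∷ var 9F ∷ var (# 10) ∷ var (# 11) ∷ var (# 12) ∷ var (# 13) ∷ []
    ρ = α ∷ β ∷ κ ∷ a ∷ b ∷ c ∷ d ∷ α′ ∷ β′ ∷ κ′ ∷ a′ ∷ b′ ∷ c′ ∷ d′ ∷ n ∷ []
    L = P.χ N (P.mulV N U V)
    R = P.mulT N (P.χ N U) (P.χ N V)

  value-recover : ∀ v → Q.interpolate n (λ i → Q.value n v (Q.pattern₇ n i)) ≡ v
  value-recover (α ∷ β ∷ κ ∷ a ∷ b ∷ c ∷ d ∷ []) =
    cong₇ (prove ρ (lookup L 0F) (var 0F) refl) (prove ρ (lookup L 1F) (var 1F) refl)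
      (prove ρ (lookup L 2F) (var 2F) refl) (prove ρ (lookup L 3F) (var 3F) refl)
      (prove ρ (lookup L 4F) (var 4F) refl) (prove ρ (lookup L 5F) (var 5F) refl)
      (prove ρ (lookup L 6F) (var 6F) refl)
    where
    ρ = α ∷ β ∷ κ ∷ a ∷ b ∷ c ∷ d ∷ []
    N = con (ℤ.+ 0)
    L = P.interpolate {7} N (λ i → P.value N (Vec.map var (Vec.allFin 7)) (P.pattern₇ N i))

  value-interpolate : ∀ c i → Q.value n (Q.interpolate n c) (Q.pattern₇ n i) ≡ c i
  value-interpolate c = λ where
      0F → prove ρ (L 0F) (var 0F) refl
      1F → prove ρ (L 1F) (var 1F) refl
      2F → prove ρ (L 2F) (var 2F) refl
      3F → prove ρ (L 3F) (var 3F) refl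
      4F → prove ρ (L 4F) (var 4F) refl
      5F → prove ρ (L 5F) (var 5F) refl
      6F → prove ρ (L 6F) (var 6F) refl
    where
    ρ = tabulate c
    N = con (ℤ.+ 0)
    L : Fin 7 → Polynomial 7
    L i = P.value N (P.interpolate N var) (P.pattern₇ N i)

  module _ (h i j k : ℚ) where
    -- Stated for values, since `ψ` is `χ⁻¹` followed by evaluation at a position; there it is one
    -- polynomial identity with h, i, j, k among the variables.
    χ⁻¹-+-value : ∀ s t p → Q.value n (Q.χ⁻¹ n h i j k (s +T t)) p ≡
      Q.value n (Q.χ⁻¹ n h i j k s) p + Q.value n (Q.χ⁻¹ n h i j k t) p
    χ⁻¹-+-value (x , y , z , (a , b , c , d)) (x′ , y′ , z′ , (a′ , b′ , c′ , d′)) (p₁₁ , p₁₂ , p₂₁ , p₂₂) =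
      prove (x ∷ y ∷ z ∷ a ∷ b ∷ c ∷ d ∷ x′ ∷ y′ ∷ z′ ∷ a′ ∷ b′ ∷ c′ ∷ d′ ∷
             p₁₁ ∷ p₁₂ ∷ p₂₁ ∷ p₂₂ ∷ n ∷ h ∷ i ∷ j ∷ k ∷ [])
        (L (P.addT N S V)) (L S :+ L V) refl
      where
      N = var (# 18)
      S V : P.Target {23} N
      S = var 0F , var 1F , var 2F , (var 3F , var 4F , var 5F , var 6F)
      V = var 7F , var 8F , var 9F , (var (# 10) , var (# 11) , var (# 12) , var (# 13))
      L : P.Target {23} N → Polynomial 23
      L t = P.value N (P.χ⁻¹ N (var (# 19)) (var (# 20)) (var (# 21)) (var (# 22)) t)
              (var (# 14) , var (# 15) , var (# 16) , var (# 17))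

    χ⁻¹-•-value : ∀ r t p → Q.value n (Q.χ⁻¹ n h i j k (r •T t)) p ≡ r * Q.value n (Q.χ⁻¹ n h i j k t) p
    χ⁻¹-•-value r (x , y , z , (a , b , c , d)) (p₁₁ , p₁₂ , p₂₁ , p₂₂) =
      prove (x ∷ y ∷ z ∷ a ∷ b ∷ c ∷ d ∷ p₁₁ ∷ p₁₂ ∷ p₂₁ ∷ p₂₂ ∷ n ∷ h ∷ i ∷ j ∷ k ∷ r ∷ [])
        (L (P.scaleT N (var (# 16)) S)) (var (# 16) :* L S) refl
      where
      N = var (# 11)
      S : P.Target {17} N
      S = var 0F , var 1F , var 2F , (var 3F , var 4F , var 5F , var 6F)
      L : P.Target {17} N → Polynomial 17
      L t = P.value N (P.χ⁻¹ N (var (# 12)) (var (# 13)) (var (# 14)) (var (# 15)) t)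
              (var 7F , var 8F , var 9F , var (# 10))

    module _ (ni≡1 : n * i ≡ 1ℚ) (qj≡1 : (n + 1ℚ) * j ≡ 1ℚ) (q+1k≡1 : (n + 1ℚ + 1ℚ) * k ≡ 1ℚ)
             (h+h≡1 : h + h ≡ 1ℚ) where
      private
        halve : ∀ x y → h * (n * (x + y) + n * (x - y)) ≡ n * x
        halve x y = trans
          (solve 4 (λ n h x y → h :* (n :* (x :+ y) :+ n :* (x :- y)) := (h :+ h) :* (n :* x)) refl n h x y)
          (trans (cong (_* (n * x)) h+h≡1) (*-identityˡ _))

        halve′ : ∀ x y → h * (n * (x + y) - n * (x - y)) ≡ n * y
        halve′ x y = trans
          (solve 4 (λ n h x y → h :* (n :* (x :+ y) :- n :* (x :- y)) := (h :+ h) :* (n :* y)) refl n h x y)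
          (trans (cong (_* (n * y)) h+h≡1) (*-identityˡ _))

        cancel : ∀ x → i * (n * x) ≡ x
        cancel x = trans (solve 3 (λ n i x → i :* (n :* x) := (n :* i) :* x) refl n i x)
          (trans (cong (_* x) ni≡1) (*-identityˡ x))

        -- A relation such as n i = 1 is invisible to normal forms. The solver therefore only
        -- isolates the products; here, and in each `collapse`, they are variables that matching on
        -- `refl` sets to 1.
        units₂ : ∀ {u v} x → u ≡ 1ℚ → v ≡ 1ℚ → u * v * x ≡ x
        units₂ x refl refl = *-identityˡ x

        -- One entry of Y M M⁻¹ = Y. It serves all four entries: M and αI + βJ keep their shape when
        -- both the columns and α, β are exchanged, which swaps (s, a) with (t, b).
        unmix-entry : ∀ s t a b → let q = n + 1ℚ in
          i * (i * k * (q * (n * (s + (q * a - b)) - n * s) + (n * (t + (q * b - a)) - n * t))) ≡ a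
        unmix-entry s t a b = trans
          (solve 7 (λ n i k s t a b → let q = n :+ con (ℤ.+ 1) in
             i :* (i :* k :* (q :* (n :* (s :+ (q :* a :- b)) :- n :* s) :+ (n :* (t :+ (q :* b :- a)) :- n :* t)))
             := n :* i :* (n :* i) :* ((q :+ con (ℤ.+ 1)) :* k :* a)) refl n i k s t a b)
          (trans (units₂ _ ni≡1 ni≡1) (trans (cong (_* a) q+1k≡1) (*-identityˡ a)))

        mix-entry : ∀ s t a b → let q = n + 1ℚ in
          n * (i * s + (q * (i * (i * k * (q * (a - s) + (b - t)))) - i * (i * k * (q * (b - t) + (a - s))))) ≡ a
        mix-entry s t a b = trans
          (solve 7 (λ n i k s t a b → let q = n :+ con (ℤ.+ 1) in
             n :* (i :* s :+ (q :* (i :* (i :* k :* (q :* (a :- s) :+ (b :- t))))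
               :- i :* (i :* k :* (q :* (b :- t) :+ (a :- s)))))
             := n :* i :* s :+ n :* i :* (n :* i) :* ((q :+ con (ℤ.+ 1)) :* k :* (a :- s))) refl n i k s t a b)
          (collapse ni≡1 q+1k≡1)
          where
          collapse : ∀ {u v} → u ≡ 1ℚ → v ≡ 1ℚ → u * s + u * u * (v * (a - s)) ≡ a
          collapse refl refl = solve 2 (λ s a →
            con (ℤ.+ 1) :* s :+ con (ℤ.+ 1) :* con (ℤ.+ 1) :* (con (ℤ.+ 1) :* (a :- s)) := a) refl s a

        -- Once α, β and the sum s of the entries of Y are known, the trivial character determines
        -- κ, because its coefficient nq(q + 1) is invertible.
        unmix-trivial : ∀ α β κ s → let q = n + 1ℚ in
          k * (i * j * (n * (α + β) + n * q * ((q + 1ℚ) * κ + s) - (n * α + n * β)) - s) ≡ κ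
        unmix-trivial α β κ s = trans
          (solve 8 (λ n i j k α β κ s → let q = n :+ con (ℤ.+ 1) in
             k :* (i :* j :* (n :* (α :+ β) :+ n :* q :* ((q :+ con (ℤ.+ 1)) :* κ :+ s) :- (n :* α :+ n :* β)) :- s)
             := n :* i :* (q :* j) :* ((q :+ con (ℤ.+ 1)) :* k :* κ) :+ (n :* i :* (q :* j) :- con (ℤ.+ 1)) :* (k :* s))
             refl n i j k α β κ s)
          (collapse ni≡1 qj≡1 q+1k≡1)
          where
          collapse : ∀ {u v w} → u ≡ 1ℚ → v ≡ 1ℚ → w ≡ 1ℚ → u * v * (w * κ) + (u * v - 1ℚ) * (k * s) ≡ κ
          collapse refl refl refl = solve 2 (λ κ t →
            con (ℤ.+ 1) :* con (ℤ.+ 1) :* (con (ℤ.+ 1) :* κ) :+ (con (ℤ.+ 1) :* con (ℤ.+ 1) :- con (ℤ.+ 1)) :* t := κ) refl κ (k * s)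

        mix-trivial : ∀ x α β a b c d → let q = n + 1ℚ in
          n * (i * α + i * β) + n * q * ((q + 1ℚ) * (k * (i * j * (x - (α + β)) - i * (a + b + c + d)))
            + (i * a + i * b + i * c + i * d)) ≡ x
        mix-trivial x α β a b c d = trans
          (solve 11 (λ n i j k x α β a b c d → let q = n :+ con (ℤ.+ 1) in
             n :* (i :* α :+ i :* β) :+ n :* q :* ((q :+ con (ℤ.+ 1)) :* (k :* (i :* j :* (x :- (α :+ β)) :- i :* (a :+ b :+ c :+ d)))
               :+ (i :* a :+ i :* b :+ i :* c :+ i :* d))
             := n :* i :* (α :+ β) :+ n :* i :* (q :* j) :* ((q :+ con (ℤ.+ 1)) :* k :* (x :- (α :+ β)))
               :+ (con (ℤ.+ 1) :- (q :+ con (ℤ.+ 1)) :* k) :* (n :* i :* q :* (a :+ b :+ c :+ d)))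
             refl n i j k x α β a b c d)
          (collapse ni≡1 qj≡1 q+1k≡1)
          where
          s = n * i * (n + 1ℚ) * (a + b + c + d)
          collapse : ∀ {u v w} → u ≡ 1ℚ → v ≡ 1ℚ → w ≡ 1ℚ →
            u * (α + β) + u * v * (w * (x - (α + β))) + (1ℚ - w) * s ≡ x
          collapse refl refl refl = solve 4 (λ x α β s →
            con (ℤ.+ 1) :* (α :+ β) :+ con (ℤ.+ 1) :* con (ℤ.+ 1) :* (con (ℤ.+ 1) :* (x :- (α :+ β))) :+ (con (ℤ.+ 1) :- con (ℤ.+ 1)) :* s := x)
            refl x α β s

      χ⁻¹∘χ : ∀ v → Q.χ⁻¹ n h i j k (Q.χ n v) ≡ v
      χ⁻¹∘χ (α ∷ β ∷ κ ∷ a ∷ b ∷ c ∷ d ∷ []) = trans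
        (cong₂ (λ s t → Q.unmix n i j k s t x m) (halve α β) (halve′ α β))
        (cong₇ (cancel α) (cancel β)
          -- The formula for κ contains the four recovered entries of Y, so these are replaced by a,
          -- b, c, d before κ itself is simplified.
          (trans (cong (λ s → k * (i * j * (x - (n * α + n * β)) - s))
                   (trans (solve 5 (λ i a b c d → i :* (a :+ b :+ c :+ d) := i :* a :+ i :* b :+ i :* c :+ i :* d)
                            refl i _ _ _ _)
                     (cong₂ _+_ (cong₂ _+_ (cong₂ _+_ ea eb) ec) ed)))
                 (unmix-trivial α β κ (a + b + c + d)))
          ea eb ec ed)
        where
        t = Q.χ n (α ∷ β ∷ κ ∷ a ∷ b ∷ c ∷ d ∷ [])
        x = proj₁ t
        m = proj₂ (proj₂ (proj₂ t))
        ea = unmix-entry α β a b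
        eb = unmix-entry β α b a
        ec = unmix-entry β α c d
        ed = unmix-entry α β d c

      χ∘χ⁻¹ : ∀ t → Q.χ n (Q.χ⁻¹ n h i j k t) ≡ t
      χ∘χ⁻¹ (x , y , z , (a , b , c , d)) = congT
        (mix-trivial x α β (i * k * (q * (a - α) + (b - β))) (i * k * (q * (b - β) + (a - α)))
          (i * k * (q * (c - β) + (d - α))) (i * k * (q * (d - α) + (c - β))))
        (trans (solve 5 (λ n i h y z → n :* (i :* (h :* (y :+ z)) :+ i :* (h :* (y :- z))) := n :* i :* (h :+ h) :* y)
                 refl n i h y z) (units₂ y ni≡1 h+h≡1))
        (trans (solve 5 (λ n i h y z → n :* (i :* (h :* (y :+ z)) :- i :* (h :* (y :- z))) := n :* i :* (h :+ h) :* z)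
                 refl n i h y z) (units₂ z ni≡1 h+h≡1))
        (mix-entry α β a b) (mix-entry β α b a) (mix-entry β α c d) (mix-entry α β d c)
        where
        q = n + 1ℚ
        α = h * (y + z)
        β = h * (y - z)

-- Finite sums and indicators

private variable
  X Y : Set

∑ : List X → (X → ℚ) → ℚ
∑ []       f = 0ℚ
∑ (x ∷ xs) f = f x + ∑ xs f

∑-cong : ∀ (xs : List X) {f g} → (∀ x → f x ≡ g x) → ∑ xs f ≡ ∑ xs g
∑-cong []       f≗g = refl
∑-cong (x ∷ xs) f≗g = cong₂ _+_ (f≗g x) (∑-cong xs f≗g)

∑-zero : ∀ (xs : List X) → ∑ xs (λ _ → 0ℚ) ≡ 0ℚ
∑-zero []       = refl
∑-zero (x ∷ xs) = trans (+-identityˡ _) (∑-zero xs)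

∑-+ : ∀ (xs : List X) (f g : X → ℚ) → ∑ xs (λ x → f x + g x) ≡ ∑ xs f + ∑ xs g
∑-+ []       f g = refl
∑-+ (x ∷ xs) f g = trans (cong (f x + g x +_) (∑-+ xs f g))
  (solve 4 (λ a b c d → a :+ b :+ (c :+ d) := a :+ c :+ (b :+ d)) refl (f x) (g x) (∑ xs f) (∑ xs g))

∑-* : ∀ (xs : List X) r f → ∑ xs (λ x → r * f x) ≡ r * ∑ xs f
∑-* []       r f = sym (*-zeroʳ r)
∑-* (x ∷ xs) r f = trans (cong (r * f x +_) (∑-* xs r f)) (sym (*-distribˡ-+ r _ _))

∑-swap : ∀ (xs : List X) (ys : List Y) (f : X → Y → ℚ) → ∑ xs (λ x → ∑ ys (f x)) ≡ ∑ ys (λ y → ∑ xs (λ x → f x y))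
∑-swap []       ys f = sym (∑-zero ys)
∑-swap (x ∷ xs) ys f = trans (cong (∑ ys (f x) +_) (∑-swap xs ys f)) (sym (∑-+ ys (f x) (λ y → ∑ xs (λ x → f x y))))

∑-map : ∀ (h : X → Y) xs f → ∑ (map h xs) f ≡ ∑ xs (f ∘ h)
∑-map h []       f = refl
∑-map h (x ∷ xs) f = cong (f (h x) +_) (∑-map h xs f)

∑-++ : ∀ (xs ys : List X) f → ∑ (xs ++ ys) f ≡ ∑ xs f + ∑ ys f
∑-++ []       ys f = sym (+-identityˡ _)
∑-++ (x ∷ xs) ys f = trans (cong (f x +_) (∑-++ xs ys f)) (sym (+-assoc (f x) (∑ xs f) (∑ ys f)))

∑-concatMap : ∀ (h : X → List Y) xs f → ∑ (concatMap h xs) f ≡ ∑ xs (λ x → ∑ (h x) f)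
∑-concatMap h []       f = refl
∑-concatMap h (x ∷ xs) f = trans (∑-++ (h x) _ f) (cong (∑ (h x) f +_) (∑-concatMap h xs f))

∑-dot : ∀ (xs : List X) {k} (c : Vec ℚ k) (fs : Vec (X → ℚ) k) →
  ∑ xs (λ x → Q.dot 1ℚ c (Vec.map (λ f → f x) fs)) ≡ Q.dot 1ℚ c (Vec.map (∑ xs) fs)
∑-dot xs []      []       = ∑-zero xs
∑-dot xs (r ∷ c) (f ∷ fs) = trans (∑-+ xs _ _) (cong₂ _+_ (∑-* xs r f) (∑-dot xs c fs))

∑-tabulate-at : ∀ {m} (h : Fin m → X) i f → (∀ j → j ≢ i → f (h j) ≡ 0ℚ) → ∑ (List.tabulate h) f ≡ f (h i)
∑-tabulate-at h zero f off = trans (cong (f (h zero) +_) (rest (h ∘ suc) (λ j → off (suc j) λ ())))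
  (+-identityʳ _)
  where
  rest : ∀ {m} (h : Fin m → _) → (∀ j → f (h j) ≡ 0ℚ) → ∑ (List.tabulate h) f ≡ 0ℚ
  rest {zero}  h z = refl
  rest {suc m} h z = trans (cong₂ _+_ (z zero) (rest (h ∘ suc) (z ∘ suc))) (+-identityˡ _)
∑-tabulate-at h (suc i) f off = trans
  (cong₂ _+_ (off zero (λ ())) (∑-tabulate-at (h ∘ suc) i f (λ j j≢i → off (suc j) λ { refl → j≢i refl })))
  (+-identityˡ _)

-- For variable m the fraction is stuck on a gcd. Its reduced form `m/1`, on which addition
-- computes, carries the coprimality proof; its field 0 is the denominator minus one.
1+m/1≡[1+m]/1 : ∀ m → 1ℚ + ℤ.+ m / 1 ≡ ℤ.+ suc m / 1
1+m/1≡[1+m]/1 m = trans (cong (1ℚ +_) (↥p/↧p≡p m/1)) (cong (λ k → (ℤ.+ 1 ℤ.+ k) / 1) (ℤ.*-identityʳ (ℤ.+ m)))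
  where
  m/1 : ℚ
  m/1 = mkℚ (ℤ.+ m) 0 (Coprimality.sym (1-coprimeTo m))

∑-tabulate-one : ∀ {m} (h : Fin m → X) → ∑ (List.tabulate h) (λ _ → 1ℚ) ≡ ℤ.+ m / 1
∑-tabulate-one {m = zero}  h = refl
∑-tabulate-one {m = suc m} h = trans (cong (1ℚ +_) (∑-tabulate-one (h ∘ suc))) (1+m/1≡[1+m]/1 m)

indicator : ∀ {P : Set} → Dec P → ℚ
indicator (yes _) = 1ℚ
indicator (no _)  = 0ℚ

indicator-cong : ∀ {P R : Set} (p : Dec P) (r : Dec R) → (P → R) → (R → P) → indicator p ≡ indicator r
indicator-cong (yes _) (yes _) _ _ = refl
indicator-cong (no _)  (no _)  _ _ = refl
indicator-cong (yes p) (no ¬r) f _ = contradiction (f p) ¬r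
indicator-cong (no ¬p) (yes r) _ g = contradiction (g r) ¬p

if-yes : ∀ {P : Set} (p : Dec P) r → P → (if ⌊ p ⌋ then r else 0ℚ) ≡ r
if-yes (yes _) r _ = refl
if-yes (no ¬p) r p = contradiction p ¬p

if-no : ∀ {P : Set} (p : Dec P) r → ¬ P → (if ⌊ p ⌋ then r else 0ℚ) ≡ 0ℚ
if-no (yes p) r ¬p = contradiction p ¬p
if-no (no _)  r _  = refl

indicator-yes : ∀ {P : Set} (p : Dec P) → P → indicator p ≡ 1ℚ
indicator-yes (yes _) _ = refl
indicator-yes (no ¬p) p = contradiction p ¬p

indicator-no : ∀ {P : Set} (p : Dec P) → ¬ P → indicator p ≡ 0ℚ
indicator-no (yes p) ¬p = contradiction p ¬p
indicator-no (no _)  _  = refl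

indicator-× : ∀ {P R : Set} (p : Dec P) (r : Dec R) → indicator p * indicator r ≡ indicator (p ×-dec r)
indicator-× (yes _) (yes _) = refl
indicator-× (yes _) (no _)  = refl
indicator-× (no _)  r       = *-zeroˡ (indicator r)

indicator-¬ : ∀ {P : Set} (p : Dec P) → indicator (¬? p) + indicator p ≡ 1ℚ
indicator-¬ (yes _) = refl
indicator-¬ (no _)  = refl

dot-distribʳ : ∀ {k} (u w : Vec ℚ k) r → Q.dot 1ℚ u w * r ≡ Q.dot 1ℚ u (Vec.map (_* r) w)
dot-distribʳ []      []      r = *-zeroˡ r
dot-distribʳ (x ∷ u) (y ∷ w) r = trans
  (solve 4 (λ x y d r → (x :* y :+ d) :* r := x :* (y :* r) :+ d :* r) refl x y (Q.dot 1ℚ u w) r)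
  (cong (x * (y * r) +_) (dot-distribʳ u w r))

dot-distribˡ : ∀ {k} r (u w : Vec ℚ k) → r * Q.dot 1ℚ u w ≡ Q.dot 1ℚ u (Vec.map (r *_) w)
dot-distribˡ r []      []      = *-zeroʳ r
dot-distribˡ r (x ∷ u) (y ∷ w) = trans
  (solve 4 (λ x y d r → r :* (x :* y :+ d) := x :* (r :* y) :+ r :* d) refl x y (Q.dot 1ℚ u w) r)
  (cong (x * (r * y) +_) (dot-distribˡ r u w))

/1-inverse : ∀ m → Σ ℚ λ i → (ℤ.+ suc m / 1) * i ≡ 1ℚ
/1-inverse m = 1/ m/1 , trans (cong (_* 1/ m/1) (↥p/↧p≡p m/1)) (*-inverseʳ m/1)
  where
  m/1 : ℚ
  m/1 = mkℚ (ℤ.+ suc m) 0 (Coprimality.sym (1-coprimeTo (suc m)))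

interpolate-cong : ∀ n {c c′ : Fin 7 → ℚ} → (∀ i → c i ≡ c′ i) → Q.interpolate n c ≡ Q.interpolate n c′
interpolate-cong n e
  rewrite e 0F | e 1F | e 2F | e 3F | e 4F | e 5F | e 6F = refl

-- Sums over SL₂ and convolution

module SL₂Algebra (F : FiniteField) where
  open FiniteField F
  open SupportClasses F

  fieldRing : CommutativeRing _ _
  fieldRing = record { isCommutativeRing = isCommutativeRing }

  open CommutativeRing fieldRing using (zeroˡ; zeroʳ)
    renaming (*-identityˡ to ·-identityˡ; +-identityˡ to ⊕-identityˡ; +-identityʳ to ⊕-identityʳ)
  module 𝔽 = IntegerCoefficients fieldRing
  open 𝔽 using () renaming (solve to solveF; _:=_ to _≔_; _:+_ to _⊞_; _:*_ to _⊡_; :-_ to ⊟_; con to conF)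

  -- The step function of elemsSL is local to Defs; unification recovers it.
  mutual
    step : Mat → List SL₂ → List SL₂
    step = _

    elemsSL-foldr : elemsSL ≡ foldr step [] allMat
    elemsSL-foldr = refl

  -- Extension by zero to all matrices. The decision is an argument so that a single `with` reduces
  -- both the list and the summand.
  extend : (SL₂ → ℚ) → (m : Mat) → Dec (det m ≡ 1#) → ℚ
  extend f m (yes p) = f (m , p)
  extend f m (no _)  = 0ℚ

  ∑-elemsSL : ∀ f → ∑ elemsSL f ≡ ∑ allMat (λ m → extend f m (det m ≟ 1#))
  ∑-elemsSL f = trans (cong (λ xs → ∑ xs f) elemsSL-foldr) (go allMat)
    where
    go : ∀ ms → ∑ (foldr step [] ms) f ≡ ∑ ms (λ m → extend f m (det m ≟ 1#))
    go []       = refl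
    go (m ∷ ms) with det m ≟ 1#
    ... | yes p = cong (f (m , p) +_) (go ms)
    ... | no _  = trans (go ms) (sym (+-identityˡ _))

  ∑F : (Carrier → ℚ) → ℚ
  ∑F = ∑ elemsF

  ∑G : (SL₂ → ℚ) → ℚ
  ∑G = ∑ elemsSL

  open Inverse enum using (to; from; strictlyInverseˡ; strictlyInverseʳ)

  ∑F-at : ∀ x f → (∀ y → y ≢ x → f y ≡ 0ℚ) → ∑F f ≡ f x
  ∑F-at x f off = trans (∑-map from (allFin size) f)
    (trans (∑-tabulate-at (λ i → i) (to x) (f ∘ from)
             (λ j j≢ → off (from j) (λ e → j≢ (trans (sym (strictlyInverseˡ j)) (cong to e)))))
      (cong f (strictlyInverseʳ x)))

  ∑F-one : ∑F (λ _ → 1ℚ) ≡ ℤ.+ size / 1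
  ∑F-one = trans (∑-map from (allFin size) _) (∑-tabulate-one {m = size} (λ i → i))

  ∑Mat-at : ∀ m f → (∀ m′ → m′ ≢ m → f m′ ≡ 0ℚ) → ∑ allMat f ≡ f m
  ∑Mat-at (a , b , c , d) f off =
    trans (∑-concatMap _ elemsF f) (trans (∑F-at a _ λ a′ a′≢a →
      trans (∑-concatMap _ elemsF f) (trans (∑-cong elemsF λ b′ →
        trans (∑-concatMap _ elemsF f) (trans (∑-cong elemsF λ c′ →
          trans (∑-map _ elemsF f) (trans (∑-cong elemsF λ d′ → off _ λ { refl → a′≢a refl })
            (∑-zero elemsF))) (∑-zero elemsF))) (∑-zero elemsF)))
    (trans (∑-concatMap _ elemsF f) (trans (∑F-at b _ λ b′ b′≢b →
        trans (∑-concatMap _ elemsF f) (trans (∑-cong elemsF λ c′ →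
          trans (∑-map _ elemsF f) (trans (∑-cong elemsF λ d′ → off _ λ { refl → b′≢b refl })
            (∑-zero elemsF))) (∑-zero elemsF)))
    (trans (∑-concatMap _ elemsF f) (trans (∑F-at c _ λ c′ c′≢c →
          trans (∑-map _ elemsF f) (trans (∑-cong elemsF λ d′ → off _ λ { refl → c′≢c refl })
            (∑-zero elemsF)))
    (trans (∑-map _ elemsF f) (∑F-at d _ λ d′ d′≢d → off _ λ { refl → d′≢d refl })))))))

  -- The determinant proofs listed in `elemsSL` are produced by `_≟_` and have to be identified with
  -- the proof that a given element carries.
  det-irrelevant : ∀ {m} (p p′ : det m ≡ 1#) → p ≡ p′
  det-irrelevant = Decidable⇒UIP.≡-irrelevant _≟_

  ∑G-at : ∀ x f → (∀ y → proj₁ y ≢ proj₁ x → f y ≡ 0ℚ) → ∑G f ≡ f x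
  ∑G-at (m , p) f off = trans (∑-elemsSL f) (trans (∑Mat-at m _ off′) at)
    where
    off′ : ∀ m′ → m′ ≢ m → extend f m′ (det m′ ≟ 1#) ≡ 0ℚ
    off′ m′ m′≢m with det m′ ≟ 1#
    ... | yes p′ = off (m′ , p′) m′≢m
    ... | no _   = refl
    at : extend f m (det m ≟ 1#) ≡ f (m , p)
    at with det m ≟ 1#
    ... | yes p′ = cong (λ e → f (m , e)) (det-irrelevant p′ p)
    ... | no ¬p  = contradiction p ¬p

  adjugate : Mat → Mat
  adjugate (a , b , c , d) = (d , ⊝ b , ⊝ c , a)

  sumℚ-∑ : ∀ (h : X → List ℚ) xs → sumℚ (concatMap h xs) ≡ ∑ xs (sumℚ ∘ h)
  sumℚ-∑ h [] = refl
  sumℚ-∑ h (x ∷ xs) = trans (++-sum (h x) _) (cong (sumℚ (h x) +_) (sumℚ-∑ h xs))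
    where
    ++-sum : ∀ rs ss → sumℚ (rs ++ ss) ≡ sumℚ rs + sumℚ ss
    ++-sum []       ss = sym (+-identityˡ _)
    ++-sum (r ∷ rs) ss = trans (cong (r +_) (++-sum rs ss)) (sym (+-assoc r _ _))

  sumℚ-map : ∀ (h : X → ℚ) xs → sumℚ (map h xs) ≡ ∑ xs h
  sumℚ-map h []       = refl
  sumℚ-map h (x ∷ xs) = cong (h x +_) (sumℚ-map h xs)

  det-⊗ : ∀ m m′ → det (m ⊗ m′) ≡ det m · det m′
  det-⊗ (a , b , c , d) (a′ , b′ , c′ , d′) =
    solveF 8 (λ a b c d a′ b′ c′ d′ →
      (a ⊡ a′ ⊞ b ⊡ c′) ⊡ (c ⊡ b′ ⊞ d ⊡ d′) ⊞ ⊟ ((a ⊡ b′ ⊞ b ⊡ d′) ⊡ (c ⊡ a′ ⊞ d ⊡ c′))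
      ≔ (a ⊡ d ⊞ ⊟ (b ⊡ c)) ⊡ (a′ ⊡ d′ ⊞ ⊟ (b′ ⊡ c′))) refl a b c d a′ b′ c′ d′

  det-adjugate : ∀ m → det (adjugate m) ≡ det m
  det-adjugate (a , b , c , d) = solveF 4 (λ a b c d →
    d ⊡ a ⊞ ⊟ (⊟ b ⊡ ⊟ c) ≔ a ⊡ d ⊞ ⊟ (b ⊡ c)) refl a b c d

  _⁻¹∙_ : SL₂ → SL₂ → SL₂
  (x , p) ⁻¹∙ (m , r) = adjugate x ⊗ m , trans (det-⊗ (adjugate x) m)
    (trans (cong₂ _·_ (trans (det-adjugate x) p) r) (·-identityˡ 1#))

  Mat-≡ : ∀ {a b c d a′ b′ c′ d′ : Carrier} → a ≡ a′ → b ≡ b′ → c ≡ c′ → d ≡ d′ →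
    _≡_ {A = Mat} (a , b , c , d) (a′ , b′ , c′ , d′)
  Mat-≡ refl refl refl refl = refl

  det-one : ∀ {δ} → δ ≡ 1# → ∀ a → δ · a ≡ a
  det-one refl a = ·-identityˡ a

  ⊗-⁻¹∙ : ∀ x m → proj₁ x ⊗ proj₁ (x ⁻¹∙ m) ≡ proj₁ m
  ⊗-⁻¹∙ ((a , b , c , d) , p) ((a′ , b′ , c′ , d′) , _) =
    Mat-≡ (top a′ c′) (top b′ d′) (bottom a′ c′) (bottom b′ d′)
    where
    top : ∀ s t → a · (d · s ⊕ ⊝ b · t) ⊕ b · (⊝ c · s ⊕ a · t) ≡ s
    top s t = trans (solveF 6 (λ a b c d s t →
      a ⊡ (d ⊡ s ⊞ ⊟ b ⊡ t) ⊞ b ⊡ (⊟ c ⊡ s ⊞ a ⊡ t) ≔ (a ⊡ d ⊞ ⊟ (b ⊡ c)) ⊡ s) refl a b c d s t) (det-one p s)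
    bottom : ∀ s t → c · (d · s ⊕ ⊝ b · t) ⊕ d · (⊝ c · s ⊕ a · t) ≡ t
    bottom s t = trans (solveF 6 (λ a b c d s t →
      c ⊡ (d ⊡ s ⊞ ⊟ b ⊡ t) ⊞ d ⊡ (⊟ c ⊡ s ⊞ a ⊡ t) ≔ (a ⊡ d ⊞ ⊟ (b ⊡ c)) ⊡ t) refl a b c d s t) (det-one p t)

  ⁻¹∙-⊗ : ∀ x m → det x ≡ 1# → adjugate x ⊗ (x ⊗ m) ≡ m
  ⁻¹∙-⊗ (a , b , c , d) (a′ , b′ , c′ , d′) p =
    Mat-≡ (top a′ c′) (top b′ d′) (bottom a′ c′) (bottom b′ d′)
    where
    top : ∀ s t → d · (a · s ⊕ b · t) ⊕ ⊝ b · (c · s ⊕ d · t) ≡ s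
    top s t = trans (solveF 6 (λ a b c d s t →
      d ⊡ (a ⊡ s ⊞ b ⊡ t) ⊞ ⊟ b ⊡ (c ⊡ s ⊞ d ⊡ t) ≔ (a ⊡ d ⊞ ⊟ (b ⊡ c)) ⊡ s) refl a b c d s t) (det-one p s)
    bottom : ∀ s t → ⊝ c · (a · s ⊕ b · t) ⊕ a · (c · s ⊕ d · t) ≡ t
    bottom s t = trans (solveF 6 (λ a b c d s t →
      ⊟ c ⊡ (a ⊡ s ⊞ b ⊡ t) ⊞ a ⊡ (c ⊡ s ⊞ d ⊡ t) ≔ (a ⊡ d ⊞ ⊟ (b ⊡ c)) ⊡ t) refl a b c d s t) (det-one p t)

  -- For fixed x the equation x y = m has the single solution y = x⁻¹m, so the inner sum collapses
  -- to one term.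
  ⋆-∑G : ∀ f g m → (f ⋆ g) m ≡ ∑G (λ x → f x * g (x ⁻¹∙ m))
  ⋆-∑G f g m = trans (sumℚ-∑ _ elemsSL) (∑-cong elemsSL λ x →
    trans (sumℚ-map _ elemsSL) (trans (∑G-at (x ⁻¹∙ m) _ (off x)) (at x)))
    where
    term : SL₂ → SL₂ → ℚ
    term x y = if ⌊ (proj₁ x ⊗ proj₁ y) ≟M proj₁ m ⌋ then f x * g y else 0ℚ
    off : ∀ x y → proj₁ y ≢ proj₁ (x ⁻¹∙ m) → term x y ≡ 0ℚ
    off x y y≢ = if-no ((proj₁ x ⊗ proj₁ y) ≟M proj₁ m) (f x * g y) λ e → y≢
      (trans (sym (⁻¹∙-⊗ (proj₁ x) (proj₁ y) (proj₂ x))) (cong (adjugate (proj₁ x) ⊗_) e))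
    at : ∀ x → term x (x ⁻¹∙ m) ≡ f x * g (x ⁻¹∙ m)
    at x = if-yes ((proj₁ x ⊗ proj₁ (x ⁻¹∙ m)) ≟M proj₁ m) _ (⊗-⁻¹∙ x m)

  -- Counting matrices with prescribed column directions

  no-zero-divisors : ∀ {x y} → x · y ≡ 0# → x ≢ 0# → y ≡ 0#
  no-zero-divisors {x} {y} xy≡0 x≢0 with inverse x x≢0
  ... | z , xz≡1 = trans (sym (det-one xz≡1 y))
    (trans (solveF 3 (λ x y z → x ⊡ z ⊡ y ≔ x ⊡ y ⊡ z) refl x y z)
      (trans (cong (_· z) xy≡0) (zeroˡ z)))

  Vec₂ : Set
  Vec₂ = Carrier × Carrier

  infix 25 _∧_
  _∧_ : Vec₂ → Vec₂ → Carrier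
  (a , c) ∧ (b , d) = a · d ⊕ ⊝ (b · c)

  ∧-antisym : ∀ u v → u ∧ v ≡ ⊝ (v ∧ u)
  ∧-antisym (a , c) (b , d) = solveF 4 (λ a b c d →
    a ⊡ d ⊞ ⊟ (b ⊡ c) ≔ ⊟ (b ⊡ c ⊞ ⊟ (a ⊡ d))) refl a b c d

  ⊝-zero : ∀ {x} → x ≡ 0# → ⊝ x ≡ 0#
  ⊝-zero refl = solveF 0 (⊟ (conF (ℤ.+ 0)) ≔ conF (ℤ.+ 0)) refl

  ∧-sym : ∀ {u v} → u ∧ v ≡ 0# → v ∧ u ≡ 0#
  ∧-sym {u} {v} e = trans (∧-antisym v u) (⊝-zero e)

  -- The three-term Plücker relation in the plane. With u ∥ v it yields both the transitivity of
  -- parallelism and the relation between the two column scalars of a matrix of determinant 1.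
  plücker : ∀ u v w z → (u ∧ w) · (v ∧ z) ≡ (u ∧ v) · (w ∧ z) ⊕ (u ∧ z) · (v ∧ w)
  plücker (a , a′) (b , b′) (c , c′) (d , d′) = solveF 8 (λ a a′ b b′ c c′ d d′ →
    (a ⊡ c′ ⊞ ⊟ (c ⊡ a′)) ⊡ (b ⊡ d′ ⊞ ⊟ (d ⊡ b′)) ≔
    (a ⊡ b′ ⊞ ⊟ (b ⊡ a′)) ⊡ (c ⊡ d′ ⊞ ⊟ (d ⊡ c′)) ⊞ (a ⊡ d′ ⊞ ⊟ (d ⊡ a′)) ⊡ (b ⊡ c′ ⊞ ⊟ (c ⊡ b′)))
    refl a a′ b b′ c c′ d d′

  plücker₀ : ∀ u v w z → u ∧ v ≡ 0# → (u ∧ w) · (v ∧ z) ≡ (u ∧ z) · (v ∧ w)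
  plücker₀ u v w z e = trans (plücker u v w z) (trans (cong (λ t → t · (w ∧ z) ⊕ (u ∧ z) · (v ∧ w)) e)
    (trans (cong (_⊕ ((u ∧ z) · (v ∧ w))) (zeroˡ _)) (⊕-identityˡ _)))

  -- Equivalent to u ≠ 0, but the witness is the transverse vector by which `∥-trans` divides and
  -- which completes u to a basis in the counts.
  Nonzero : Vec₂ → Set
  Nonzero u = Σ Vec₂ λ w → u ∧ w ≢ 0#

  ∥-trans : ∀ {u v w} → Nonzero u → u ∧ v ≡ 0# → u ∧ w ≡ 0# → v ∧ w ≡ 0#
  ∥-trans {u} {v} {w} (z , uz≢0) uv uw = no-zero-divisors
    (trans (sym (plücker₀ u v w z uv)) (trans (cong (_· (v ∧ z)) uw) (zeroˡ _))) uz≢0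

  par : Vec₂ → Vec₂ → ℚ
  par u v = indicator (u ∧ v ≟ 0#)

  par-sym : ∀ u v → par u v ≡ par v u
  par-sym u v = indicator-cong (u ∧ v ≟ 0#) (v ∧ u ≟ 0#) (∧-sym {u} {v}) (∧-sym {v} {u})

  par-subst : ∀ {u v} → Nonzero u → Nonzero v → u ∧ v ≡ 0# → ∀ w → par u w ≡ par v w
  par-subst {u} {v} u≢0 v≢0 uv w = indicator-cong (u ∧ w ≟ 0#) (v ∧ w ≟ 0#)
    (∥-trans u≢0 uv) (∥-trans v≢0 (∧-sym {u} {v} uv))

  -- Where u ∥ v holds, u may be replaced by v in any further condition. This moves conditions on
  -- the summation variable out of a sum.
  par-absorb : ∀ {u v} → Nonzero u → Nonzero v → ∀ w → par u v * par u w ≡ par v w * par u v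
  par-absorb {u} {v} u≢0 v≢0 w with u ∧ v ≟ 0#
  ... | yes uv = trans (*-identityˡ (par u w)) (trans (par-subst u≢0 v≢0 uv w) (sym (*-identityʳ (par v w))))
  ... | no _   = trans (*-zeroˡ (par u w)) (sym (*-zeroʳ (par v w)))

  1≢0 : 1# ≢ 0#
  1≢0 e = 0≢1 (sym e)

  -- The value 0 at 0 lets the family `M` below be indexed by all scalars; `hit?` discards t = 0.
  inv : Carrier → Carrier
  inv t with t ≟ 0#
  ... | yes _ = 0#
  ... | no t≢0 = proj₁ (inverse t t≢0)

  inv-inverse : ∀ t → t ≢ 0# → t · inv t ≡ 1#
  inv-inverse t t≢0 with t ≟ 0#
  ... | yes t≡0 = contradiction t≡0 t≢0
  ... | no t≢0′ = proj₂ (inverse t t≢0′)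

  col₁ col₂ : SL₂ → Vec₂
  col₁ ((a , b , c , d) , _) = a , c
  col₂ ((a , b , c , d) , _) = b , d

  col-∧ : ∀ x → col₁ x ∧ col₂ x ≡ 1#
  col-∧ (_ , p) = p

  col₁-nonzero : ∀ x → Nonzero (col₁ x)
  col₁-nonzero x = col₂ x , λ e → 1≢0 (trans (sym (col-∧ x)) e)

  col₂-nonzero : ∀ x → Nonzero (col₂ x)
  col₂-nonzero x = col₁ x , λ e → 1≢0 (trans (sym (col-∧ x)) (∧-sym {col₂ x} {col₁ x} e))

  size≡suc : size ≡ suc (size ∸ 1)
  size≡suc with size | Inverse.to enum 0#
  ... | suc _ | _ = refl

  ∑F-one-qm1 : ∑F (λ _ → 1ℚ) ≡ qm1 + 1ℚ
  ∑F-one-qm1 = trans ∑F-one (trans (cong (λ m → ℤ.+ m / 1) size≡suc)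
    (trans (sym (1+m/1≡[1+m]/1 (size ∸ 1))) (solve 1 (λ n → con (ℤ.+ 1) :+ n := n :+ con (ℤ.+ 1)) refl qm1)))

  ∑F-nonzero : ∑F (λ t → indicator (¬? (t ≟ 0#))) ≡ qm1
  ∑F-nonzero = trans
    (solve 1 (λ n → n := n :+ con (ℤ.+ 1) :- con (ℤ.+ 1)) refl _)
    (trans (cong (_- 1ℚ) (trans (cong (∑F nz +_) (sym zero-once)) (trans (sym (∑-+ elemsF nz z))
        (trans (∑-cong elemsF λ t → indicator-¬ (t ≟ 0#)) ∑F-one-qm1))))
      (solve 1 (λ n → n :+ con (ℤ.+ 1) :- con (ℤ.+ 1) := n) refl qm1))
    where
    nz z : Carrier → ℚ
    nz t = indicator (¬? (t ≟ 0#))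
    z t = indicator (t ≟ 0#)
    zero-once : ∑F z ≡ 1ℚ
    zero-once = trans (∑F-at 0# z (λ t t≢0 → indicator-no (t ≟ 0#) t≢0)) (indicator-yes (0# ≟ 0#) refl)

  -- Cramer's rule (u ∧ v) w = (w ∧ v) u + (u ∧ w) v, whose last term vanishes for w ∥ u.
  cramer₁ : ∀ {u v e} → (u ∧ v) · e ≡ 1# → ∀ w → u ∧ w ≡ 0# →
    w ≡ ((w ∧ v) · e · proj₁ u , (w ∧ v) · e · proj₂ u)
  cramer₁ {a , a′} {b , b′} {e} δe≡1 (c , c′) uw≡0 = cong₂ _,_
    (trans (sym (det-one δe≡1 c)) (trans
      (solveF 7 (λ a a′ b b′ c c′ e → (a ⊡ b′ ⊞ ⊟ (b ⊡ a′)) ⊡ e ⊡ c ≔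
         (c ⊡ b′ ⊞ ⊟ (b ⊡ c′)) ⊡ e ⊡ a ⊞ (a ⊡ c′ ⊞ ⊟ (c ⊡ a′)) ⊡ (e ⊡ b)) refl a a′ b b′ c c′ e)
      (vanish (e · b))))
    (trans (sym (det-one δe≡1 c′)) (trans
      (solveF 7 (λ a a′ b b′ c c′ e → (a ⊡ b′ ⊞ ⊟ (b ⊡ a′)) ⊡ e ⊡ c′ ≔
         (c ⊡ b′ ⊞ ⊟ (b ⊡ c′)) ⊡ e ⊡ a′ ⊞ (a ⊡ c′ ⊞ ⊟ (c ⊡ a′)) ⊡ (e ⊡ b′)) refl a a′ b b′ c c′ e)
      (vanish (e · b′))))
    where
    vanish : ∀ {x} y → x ⊕ (a , a′) ∧ (c , c′) · y ≡ x
    vanish {x} y = trans (cong (λ t → x ⊕ t · y) uw≡0) (trans (cong (x ⊕_) (zeroˡ y)) (⊕-identityʳ x))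

  cramer₂ : ∀ {u v e} → (u ∧ v) · e ≡ 1# → ∀ w → v ∧ w ≡ 0# →
    w ≡ ((u ∧ w) · e · proj₁ v , (u ∧ w) · e · proj₂ v)
  cramer₂ {a , a′} {b , b′} {e} δe≡1 (c , c′) vw≡0 = cong₂ _,_
    (trans (sym (det-one δe≡1 c)) (trans
      (solveF 7 (λ a a′ b b′ c c′ e → (a ⊡ b′ ⊞ ⊟ (b ⊡ a′)) ⊡ e ⊡ c ≔
         (a ⊡ c′ ⊞ ⊟ (c ⊡ a′)) ⊡ e ⊡ b ⊞ (b ⊡ c′ ⊞ ⊟ (c ⊡ b′)) ⊡ (⊟ e ⊡ a)) refl a a′ b b′ c c′ e)
      (vanish (⊝ e · a))))
    (trans (sym (det-one δe≡1 c′)) (trans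
      (solveF 7 (λ a a′ b b′ c c′ e → (a ⊡ b′ ⊞ ⊟ (b ⊡ a′)) ⊡ e ⊡ c′ ≔
         (a ⊡ c′ ⊞ ⊟ (c ⊡ a′)) ⊡ e ⊡ b′ ⊞ (b ⊡ c′ ⊞ ⊟ (c ⊡ b′)) ⊡ (⊟ e ⊡ a′)) refl a a′ b b′ c c′ e)
      (vanish (⊝ e · a′))))
    where
    vanish : ∀ {x} y → x ⊕ (b , b′) ∧ (c , c′) · y ≡ x
    vanish {x} y = trans (cong (λ t → x ⊕ t · y) vw≡0) (trans (cong (x ⊕_) (zeroˡ y)) (⊕-identityʳ x))

  infixr 24 _⟨·⟩_
  _⟨·⟩_ : Carrier → Vec₂ → Vec₂
  t ⟨·⟩ (a , c) = t · a , t · c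

  ⟨·⟩-∧ : ∀ t u v → (t ⟨·⟩ u) ∧ v ≡ t · u ∧ v
  ⟨·⟩-∧ t (a , c) (b , d) = solveF 5 (λ t a c b d →
    t ⊡ a ⊡ d ⊞ ⊟ (b ⊡ (t ⊡ c)) ≔ t ⊡ (a ⊡ d ⊞ ⊟ (b ⊡ c))) refl t a c b d

  ⟨·⟩-∧-⟨·⟩ : ∀ s t u v → (s ⟨·⟩ u) ∧ (t ⟨·⟩ v) ≡ s · t · u ∧ v
  ⟨·⟩-∧-⟨·⟩ s t (a , c) (b , d) = solveF 6 (λ s t a c b d →
    s ⊡ a ⊡ (t ⊡ d) ⊞ ⊟ (t ⊡ b ⊡ (s ⊡ c)) ≔ s ⊡ t ⊡ (a ⊡ d ⊞ ⊟ (b ⊡ c))) refl s t a c b d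

  ⟨·⟩-∥ : ∀ t u → (t ⟨·⟩ u) ∧ u ≡ 0#
  ⟨·⟩-∥ t (a , c) = solveF 3 (λ t a c → t ⊡ a ⊡ c ⊞ ⊟ (a ⊡ (t ⊡ c)) ≔ conF (ℤ.+ 0)) refl t a c

  columns : Vec₂ → Vec₂ → Mat
  columns (a , c) (b , d) = a , b , c , d

  module _ {u v : Vec₂} (δ≢0 : u ∧ v ≢ 0#) where
    private
      e : Carrier
      e = proj₁ (inverse (u ∧ v) δ≢0)

      δe≡1 : (u ∧ v) · e ≡ 1#
      δe≡1 = proj₂ (inverse (u ∧ v) δ≢0)

      -- Columns on the lines of u and v are s u and t v with s t (u ∧ v) = 1, so one nonzero scalar
      -- parametrises these matrices.
      M : Carrier → Mat
      M t = columns (t ⟨·⟩ u) ((inv t · e) ⟨·⟩ v)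

      det-M : ∀ t → t ≢ 0# → det (M t) ≡ 1#
      det-M t t≢0 = trans (⟨·⟩-∧-⟨·⟩ t (inv t · e) u v)
        (trans (solveF 4 (λ t i e δ → t ⊡ (i ⊡ e) ⊡ δ ≔ t ⊡ i ⊡ (δ ⊡ e)) refl t (inv t) e (u ∧ v))
          (trans (det-one (inv-inverse t t≢0) _) δe≡1))

      hit? : ∀ (x : SL₂) t → Dec ((t ≢ 0#) × (proj₁ x ≡ M t))
      hit? x t = ¬? (t ≟ 0#) ×-dec (proj₁ x ≟M M t)

      both? : ∀ (x : SL₂) → Dec ((col₁ x ∧ u ≡ 0#) × (col₂ x ∧ v ≡ 0#))
      both? x = (col₁ x ∧ u ≟ 0#) ×-dec (col₂ x ∧ v ≟ 0#)

      scale : SL₂ → Carrier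
      scale x = (col₁ x ∧ v) · e

      scale-M : ∀ (x : SL₂) t → proj₁ x ≡ M t → t ≡ scale x
      scale-M (_ , _) t refl = sym (trans (cong (_· e) (⟨·⟩-∧ t u v))
        (trans (solveF 3 (λ t δ e → t ⊡ δ ⊡ e ≔ δ ⊡ e ⊡ t) refl t (u ∧ v) e) (det-one δe≡1 t)))

      hit⇒both : ∀ (x : SL₂) t → proj₁ x ≡ M t → (col₁ x ∧ u ≡ 0#) × (col₂ x ∧ v ≡ 0#)
      hit⇒both (_ , _) t refl = ⟨·⟩-∥ t u , ⟨·⟩-∥ (inv t · e) v

      both⇒hit : ∀ x → (col₁ x ∧ u ≡ 0#) × (col₂ x ∧ v ≡ 0#) → (scale x ≢ 0#) × (proj₁ x ≡ M (scale x))
      both⇒hit x (x₁u , x₂v) = τ≢0 , cong₂ columns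
        (cramer₁ δe≡1 (col₁ x) (∧-sym {col₁ x} {u} x₁u))
        (trans (cramer₂ δe≡1 (col₂ x) (∧-sym {col₂ x} {v} x₂v))
          (cong (λ i → (i · e) ⟨·⟩ v) (sym inv-τ)))
        where
        τ = scale x
        -- By Plücker (x₁ ∧ v)(u ∧ x₂) = (x₁ ∧ x₂)(u ∧ v) = u ∧ v. Hence u ∧ x₂ is the inverse of τ,
        -- and by Cramer it is, up to the factor e, the coefficient of x₂ along v.
        τr≡1 : τ · u ∧ col₂ x ≡ 1#
        τr≡1 = trans (solveF 3 (λ p e r → p ⊡ e ⊡ r ≔ p ⊡ r ⊡ e) refl (col₁ x ∧ v) e (u ∧ col₂ x))
          (trans (cong (_· e) (trans (plücker₀ (col₁ x) u v (col₂ x) x₁u) (det-one (col-∧ x) (u ∧ v)))) δe≡1)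
        τ≢0 : τ ≢ 0#
        τ≢0 τ≡0 = 0≢1 (trans (sym (zeroˡ _)) (trans (cong (_· u ∧ col₂ x) (sym τ≡0)) τr≡1))
        inv-τ : inv τ ≡ u ∧ col₂ x
        inv-τ = trans (sym (det-one τr≡1 (inv τ)))
          (trans (solveF 3 (λ t r i → t ⊡ r ⊡ i ≔ t ⊡ i ⊡ r) refl τ (u ∧ col₂ x) (inv τ))
            (det-one (inv-inverse τ τ≢0) (u ∧ col₂ x)))

      hits-of-element : ∀ x → ∑F (λ t → indicator (hit? x t)) ≡ par (col₁ x) u * par (col₂ x) v
      hits-of-element x = trans
        (∑F-at (scale x) _ (λ t t≢ → indicator-no (hit? x t) λ (_ , x≡) → t≢ (scale-M x t x≡)))
        (trans (indicator-cong (hit? x (scale x)) (both? x) (λ (_ , x≡) → hit⇒both x (scale x) x≡) (both⇒hit x))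
          (sym (indicator-× (col₁ x ∧ u ≟ 0#) (col₂ x ∧ v ≟ 0#))))

      hits-of-scalar : ∀ t → ∑G (λ x → indicator (hit? x t)) ≡ indicator (¬? (t ≟ 0#))
      hits-of-scalar t = go (t ≟ 0#)
        where
        go : Dec (t ≡ 0#) → ∑G (λ x → indicator (hit? x t)) ≡ indicator (¬? (t ≟ 0#))
        go (yes t≡0) = trans (∑-cong elemsSL λ x → indicator-no (hit? x t) λ (t≢0 , _) → t≢0 t≡0)
          (trans (∑-zero elemsSL) (sym (indicator-no (¬? (t ≟ 0#)) λ t≢0 → t≢0 t≡0)))
        go (no t≢0) = trans
          (∑G-at (M t , det-M t t≢0) _ (λ y y≢ → indicator-no (hit? y t) λ (_ , y≡) → y≢ y≡))
          (trans (indicator-yes (hit? (M t , det-M t t≢0) t) (t≢0 , refl))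
            (sym (indicator-yes (¬? (t ≟ 0#)) t≢0)))

    -- Double counting of the pairs x = `M t`, t ≠ 0: an admissible x has exactly one t, its
    -- coordinate `scale x`, and each t ≠ 0 has exactly one x.
    count-transverse : ∑G (λ x → par (col₁ x) u * par (col₂ x) v) ≡ qm1
    count-transverse = trans (∑-cong elemsSL λ x → sym (hits-of-element x))
      (trans (∑-swap elemsSL elemsF _) (trans (∑-cong elemsF hits-of-scalar) ∑F-nonzero))

  par-product-zero : ∀ {u v} → Nonzero u → Nonzero v → u ∧ v ≡ 0# → ∀ x → par (col₁ x) u * par (col₂ x) v ≡ 0ℚ
  par-product-zero {u} {v} u≢0 v≢0 uv x = trans
    (indicator-× (col₁ x ∧ u ≟ 0#) (col₂ x ∧ v ≟ 0#))
    (indicator-no ((col₁ x ∧ u ≟ 0#) ×-dec (col₂ x ∧ v ≟ 0#)) λ (x₁u , x₂v) →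
      0≢1 (sym (trans (sym (col-∧ x))
        (∥-trans v≢0 (∥-trans u≢0 uv (∧-sym {col₁ x} {u} x₁u)) (∧-sym {col₂ x} {v} x₂v)))))

  count-pair : ∀ {u v} → Nonzero u → Nonzero v →
    ∑G (λ x → par (col₁ x) u * par (col₂ x) v) ≡ qm1 * (1ℚ - par u v)
  count-pair {u} {v} u≢0 v≢0 = go (u ∧ v ≟ 0#)
    where
    go : (d : Dec (u ∧ v ≡ 0#)) → ∑G (λ x → par (col₁ x) u * par (col₂ x) v) ≡ qm1 * (1ℚ - indicator d)
    go (yes uv) = trans (∑-cong elemsSL (par-product-zero u≢0 v≢0 uv))
      (trans (∑-zero elemsSL) (sym (*-zeroʳ qm1)))
    go (no δ≢0) = trans (count-transverse δ≢0) (sym (*-identityʳ qm1))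

  infix 23 _⊹_⟨·⟩_
  _⊹_⟨·⟩_ : Vec₂ → Carrier → Vec₂ → Vec₂
  (a , c) ⊹ s ⟨·⟩ (b , d) = a ⊕ s · b , c ⊕ s · d

  ∧-⊹ : ∀ w v s u → w ∧ (v ⊹ s ⟨·⟩ u) ≡ w ∧ v ⊕ s · w ∧ u
  ∧-⊹ (a , a′) (b , b′) s (c , c′) = solveF 7 (λ a a′ b b′ s c c′ →
    a ⊡ (b′ ⊞ s ⊡ c′) ⊞ ⊟ ((b ⊞ s ⊡ c) ⊡ a′) ≔
    a ⊡ b′ ⊞ ⊟ (b ⊡ a′) ⊞ s ⊡ (a ⊡ c′ ⊞ ⊟ (c ⊡ a′))) refl a a′ b b′ s c c′

  ∧-⊹-∥ : ∀ w v s u → w ∧ u ≡ 0# → w ∧ (v ⊹ s ⟨·⟩ u) ≡ w ∧ v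
  ∧-⊹-∥ w v s u wu = trans (∧-⊹ w v s u) (trans (cong (λ t → w ∧ v ⊕ s · t) wu)
    (trans (cong (w ∧ v ⊕_) (zeroʳ s)) (⊕-identityʳ _)))

  ∧-self : ∀ u → u ∧ u ≡ 0#
  ∧-self (a , c) = solveF 2 (λ a c → a ⊡ c ⊞ ⊟ (a ⊡ c) ≔ conF (ℤ.+ 0)) refl a c

  module _ {u v : Vec₂} (δ≢0 : u ∧ v ≢ 0#) where
    line : Carrier → Vec₂
    line s = v ⊹ s ⟨·⟩ u

    u∧line≢0 : ∀ s → u ∧ line s ≢ 0#
    u∧line≢0 s e = δ≢0 (trans (sym (∧-⊹-∥ u v s u (∧-self u))) e)

    line∧u≢0 : ∀ s → line s ∧ u ≢ 0#
    line∧u≢0 s e = u∧line≢0 s (∧-sym {line s} {u} e)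

    -- The q + 1 points of the projective line are u and the v + s u.
    projective-line : ∀ {w} → Nonzero w → ∑F (λ s → par w (line s)) ≡ 1ℚ - par w u
    projective-line {w} w≢0 = go (w ∧ u ≟ 0#)
      where
      go : (d : Dec (w ∧ u ≡ 0#)) → ∑F (λ s → par w (line s)) ≡ 1ℚ - indicator d
      go (yes wu) = trans
        (∑-cong elemsF λ s → indicator-no (w ∧ line s ≟ 0#) λ e →
          δ≢0 (∥-trans w≢0 wu (trans (sym (∧-⊹-∥ w v s u wu)) e)))
        (∑-zero elemsF)
      go (no wu≢0) = trans
        (∑F-at s₀ _ λ s s≢ → indicator-no (w ∧ line s ≟ 0#) λ e → s≢ (unique s (trans (sym (∧-⊹ w v s u)) e)))
        (indicator-yes (w ∧ line s₀ ≟ 0#) (trans (∧-⊹ w v s₀ u) root))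
        where
        g h z s₀ : Carrier
        g = w ∧ u
        h = w ∧ v
        z = proj₁ (inverse g wu≢0)
        s₀ = ⊝ (h · z)
        gz≡1 : g · z ≡ 1#
        gz≡1 = proj₂ (inverse g wu≢0)
        root : h ⊕ s₀ · g ≡ 0#
        root = trans (solveF 3 (λ g h z → h ⊞ ⊟ (h ⊡ z) ⊡ g ≔ h ⊞ ⊟ (g ⊡ z ⊡ h)) refl g h z)
          (trans (cong (λ t → h ⊕ ⊝ t) (det-one gz≡1 h))
            (solveF 1 (λ h → h ⊞ ⊟ h ≔ conF (ℤ.+ 0)) refl h))
        unique : ∀ s → h ⊕ s · g ≡ 0# → s ≡ s₀
        unique s e = trans (sym (det-one gz≡1 s))
          (trans (solveF 4 (λ g h z s → g ⊡ z ⊡ s ≔ (h ⊞ s ⊡ g) ⊡ z ⊞ ⊟ (h ⊡ z)) refl g h z s)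
            (trans (cong (λ t → t · z ⊕ s₀) e) (trans (cong (_⊕ s₀) (zeroˡ z)) (⊕-identityˡ s₀))))

    private
      sum-const : ∑F (λ _ → qm1) ≡ qm1 * (qm1 + 1ℚ)
      sum-const = trans (∑-cong elemsF λ _ → sym (*-identityʳ qm1))
        (trans (∑-* elemsF qm1 (λ _ → 1ℚ)) (cong (qm1 *_) ∑F-one-qm1))

    -- If x₁ ∥ u then x₂ is not parallel to u, so it lies on exactly one of the q remaining lines;
    -- each of them contributes n matrices.
    count-col₁ : ∑G (λ x → par (col₁ x) u) ≡ qm1 * (qm1 + 1ℚ)
    count-col₁ = trans (∑-cong elemsSL expand) (trans (∑-swap elemsSL elemsF _)
      (trans (∑-cong elemsF λ s → count-transverse (u∧line≢0 s)) sum-const))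
      where
      expand : ∀ x → par (col₁ x) u ≡ ∑F (λ s → par (col₁ x) u * par (col₂ x) (line s))
      expand x = begin
        p              ≡⟨ solve 1 (λ p → p := p :* con (ℤ.+ 1) :- con (ℤ.+ 0)) refl p ⟩
        p * 1ℚ - 0ℚ    ≡⟨ cong (λ t → p * 1ℚ - t) (par-product-zero (v , δ≢0) (v , δ≢0) (∧-self u) x) ⟨
        p * 1ℚ - p * r ≡⟨ solve 2 (λ p r → p :* con (ℤ.+ 1) :- p :* r := p :* (con (ℤ.+ 1) :- r)) refl p r ⟩
        p * (1ℚ - r)   ≡⟨ cong (p *_) (projective-line (col₂-nonzero x)) ⟨
        p * ∑F (λ s → par (col₂ x) (line s)) ≡⟨ ∑-* elemsF p _ ⟨
        ∑F (λ s → p * par (col₂ x) (line s)) ∎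
        where
        p = par (col₁ x) u
        r = par (col₂ x) u

    count-col₂ : ∑G (λ x → par (col₂ x) u) ≡ qm1 * (qm1 + 1ℚ)
    count-col₂ = trans (∑-cong elemsSL expand) (trans (∑-swap elemsSL elemsF _)
      (trans (∑-cong elemsF λ s → count-transverse (line∧u≢0 s)) sum-const))
      where
      expand : ∀ x → par (col₂ x) u ≡ ∑F (λ s → par (col₁ x) (line s) * par (col₂ x) u)
      expand x = begin
        r              ≡⟨ solve 1 (λ r → r := r :* con (ℤ.+ 1) :- con (ℤ.+ 0)) refl r ⟩
        r * 1ℚ - 0ℚ    ≡⟨ cong (λ t → r * 1ℚ - t) (par-product-zero (v , δ≢0) (v , δ≢0) (∧-self u) x) ⟨
        r * 1ℚ - p * r ≡⟨ solve 2 (λ p r → r :* con (ℤ.+ 1) :- p :* r := r :* (con (ℤ.+ 1) :- p)) refl p r ⟩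
        r * (1ℚ - p)   ≡⟨ cong (r *_) (projective-line (col₁-nonzero x)) ⟨
        r * ∑F (λ s → par (col₁ x) (line s)) ≡⟨ ∑-* elemsF r _ ⟨
        ∑F (λ s → r * par (col₁ x) (line s)) ≡⟨ ∑-cong elemsF (λ s → *-comm r (par (col₁ x) (line s))) ⟩
        ∑F (λ s → par (col₁ x) (line s) * r) ∎
        where
        p = par (col₁ x) u
        r = par (col₂ x) u

  -- The first column lies on exactly one of the q + 1 lines, and `count-col₁` counts each case.
  count-all : ∀ {u v} → u ∧ v ≢ 0# → ∑G (λ _ → 1ℚ) ≡ qm1 * (qm1 + 1ℚ) * (qm1 + 1ℚ + 1ℚ)
  count-all {u} δ≢0 = begin
    ∑G (λ _ → 1ℚ)
      ≡⟨ ∑-cong elemsSL expand ⟩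
    ∑G (λ x → par (col₁ x) u + ∑F (λ s → par (col₁ x) (line δ≢0 s)))
      ≡⟨ ∑-+ elemsSL (λ x → par (col₁ x) u) (λ x → ∑F (λ s → par (col₁ x) (line δ≢0 s))) ⟩
    ∑G (λ x → par (col₁ x) u) + ∑G (λ x → ∑F (λ s → par (col₁ x) (line δ≢0 s)))
      ≡⟨ cong₂ _+_ (count-col₁ δ≢0) (∑-swap elemsSL elemsF _) ⟩
    |P| + ∑F (λ s → ∑G (λ x → par (col₁ x) (line δ≢0 s)))
      ≡⟨ cong (|P| +_) (∑-cong elemsF λ s → trans (count-col₁ (line∧u≢0 δ≢0 s)) (sym (*-identityʳ |P|))) ⟩
    |P| + ∑F (λ _ → |P| * 1ℚ)
      ≡⟨ cong (|P| +_) (trans (∑-* elemsF |P| (λ _ → 1ℚ)) (cong (|P| *_) ∑F-one-qm1)) ⟩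
    |P| + |P| * (qm1 + 1ℚ)
      ≡⟨ solve 2 (λ p q → p :+ p :* q := p :* (q :+ con (ℤ.+ 1))) refl |P| (qm1 + 1ℚ) ⟩
    |P| * (qm1 + 1ℚ + 1ℚ) ∎
    where
    |P| = qm1 * (qm1 + 1ℚ)
    expand : ∀ x → 1ℚ ≡ par (col₁ x) u + ∑F (λ s → par (col₁ x) (line δ≢0 s))
    expand x = trans (solve 1 (λ p → con (ℤ.+ 1) := p :+ (con (ℤ.+ 1) :- p)) refl (par (col₁ x) u))
      (cong (par (col₁ x) u +_) (sym (projective-line δ≢0 (col₁-nonzero x))))

  -- The convolution product of the span of A, B, G and the Pᵢⱼ

  relative : Vec₂ → Vec₂ → SL₂ → Q.Point qm1
  relative u₁ u₂ m = par u₁ (col₁ m) , par u₁ (col₂ m) , par u₂ (col₁ m) , par u₂ (col₂ m)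

  e₁ e₂ : Vec₂
  e₁ = 1# , 0#
  e₂ = 0# , 1#

  e₁∧e₂≢0 : e₁ ∧ e₂ ≢ 0#
  e₁∧e₂≢0 e = 0≢1 (sym (trans (solveF 0
    (conF (ℤ.+ 1) ≔ conF (ℤ.+ 1) ⊡ conF (ℤ.+ 1) ⊞ ⊟ (conF (ℤ.+ 0) ⊡ conF (ℤ.+ 0))) refl) e))

  e₂∧e₁≢0 : e₂ ∧ e₁ ≢ 0#
  e₂∧e₁≢0 e = e₁∧e₂≢0 (∧-sym {e₂} {e₁} e)

  position : SL₂ → Q.Point qm1
  position m = par (col₁ m) e₁ , par (col₂ m) e₁ , par (col₁ m) e₂ , par (col₂ m) e₂

  zeroPattern : SL₂ → Q.Point qm1
  zeroPattern ((a , b , c , d) , _) =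
    indicator (c ≟ 0#) , indicator (d ≟ 0#) , indicator (a ≟ 0#) , indicator (b ≟ 0#)

  point-≡ : ∀ {a b c d a′ b′ c′ d′ : ℚ} → a ≡ a′ → b ≡ b′ → c ≡ c′ → d ≡ d′ →
    _≡_ {A = Q.Point qm1} (a , b , c , d) (a′ , b′ , c′ , d′)
  point-≡ refl refl refl refl = refl

  indicator-≡ : ∀ {x y} → x ≡ y → indicator (x ≟ 0#) ≡ indicator (y ≟ 0#)
  indicator-≡ refl = refl

  indicator-⊝ : ∀ {x y} → x ≡ ⊝ y → indicator (x ≟ 0#) ≡ indicator (y ≟ 0#)
  indicator-⊝ {x} {y} x≡-y = indicator-cong (x ≟ 0#) (y ≟ 0#)
    (λ x≡0 → trans (solveF 1 (λ y → y ≔ ⊟ (⊟ y)) refl y) (⊝-zero (trans (sym x≡-y) x≡0)))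
    (λ y≡0 → trans x≡-y (⊝-zero y≡0))

  ∧-e₁ : ∀ u → u ∧ e₁ ≡ ⊝ (proj₂ u)
  ∧-e₁ (a , c) = solveF 2 (λ a c → a ⊡ conF (ℤ.+ 0) ⊞ ⊟ (conF (ℤ.+ 1) ⊡ c) ≔ ⊟ c) refl a c

  ∧-e₂ : ∀ u → u ∧ e₂ ≡ proj₁ u
  ∧-e₂ (a , c) = solveF 2 (λ a c → a ⊡ conF (ℤ.+ 1) ⊞ ⊟ (conF (ℤ.+ 0) ⊡ c) ≔ a) refl a c

  position≡zeroPattern : ∀ m → position m ≡ zeroPattern m
  position≡zeroPattern m = point-≡ (indicator-⊝ (∧-e₁ (col₁ m))) (indicator-⊝ (∧-e₁ (col₂ m)))
    (indicator-≡ (∧-e₂ (col₁ m))) (indicator-≡ (∧-e₂ (col₂ m)))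

  relative-e₁-e₂ : ∀ m → relative e₁ e₂ m ≡ position m
  relative-e₁-e₂ m = point-≡ (par-sym e₁ (col₁ m)) (par-sym e₁ (col₂ m)) (par-sym e₂ (col₁ m)) (par-sym e₂ (col₂ m))

  relative-e₂-e₁ : ∀ m → relative e₂ e₁ m ≡ Q.swapRows qm1 (position m)
  relative-e₂-e₁ m = point-≡ (par-sym e₂ (col₁ m)) (par-sym e₂ (col₂ m)) (par-sym e₁ (col₁ m)) (par-sym e₁ (col₂ m))

  -- Up to sign the entries of x⁻¹m are the ∧-products of columns of x with columns of m, because
  -- x⁻¹ is the adjugate.
  position-⁻¹∙ : ∀ x m → position (x ⁻¹∙ m) ≡ relative (col₁ x) (col₂ x) m
  position-⁻¹∙ x@((a , b , c , d) , _) m@((a′ , b′ , c′ , d′) , _) = trans (position≡zeroPattern (x ⁻¹∙ m))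
    (point-≡ (indicator-≡ (bottom a′ c′)) (indicator-≡ (bottom b′ d′)) (indicator-⊝ (top a′ c′)) (indicator-⊝ (top b′ d′)))
    where
    bottom : ∀ s t → ⊝ c · s ⊕ a · t ≡ (a , c) ∧ (s , t)
    bottom s t = solveF 4 (λ a c s t → ⊟ c ⊡ s ⊞ a ⊡ t ≔ a ⊡ t ⊞ ⊟ (s ⊡ c)) refl a c s t
    top : ∀ s t → d · s ⊕ ⊝ b · t ≡ ⊝ ((b , d) ∧ (s , t))
    top s t = solveF 4 (λ b d s t → d ⊡ s ⊞ ⊟ b ⊡ t ≔ ⊟ (b ⊡ t ⊞ ⊟ (s ⊡ d))) refl b d s t

  Φ : Vec ℚ 7 → QG
  Φ v x = Q.value qm1 v (position x)

  module _ (v : Vec ℚ 7) (m : SL₂) where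
    private
      m₁ m₂ : Vec₂
      m₁ = col₁ m
      m₂ = col₂ m

      m₁≢0 : Nonzero m₁
      m₁≢0 = col₁-nonzero m

      m₂≢0 : Nonzero m₂
      m₂≢0 = col₂-nonzero m

      translate : SL₂ → ℚ
      translate x = Q.value qm1 v (relative (col₁ x) (col₂ x) m)

      p₁₁ p₁₂ p₂₁ p₂₂ : SL₂ → ℚ
      p₁₁ x = par (col₁ x) m₁
      p₁₂ x = par (col₁ x) m₂
      p₂₁ x = par (col₂ x) m₁
      p₂₂ x = par (col₂ x) m₂

      ∑-value : ∀ (f : SL₂ → ℚ) → ∑G (λ x → f x * translate x) ≡ Q.dot 1ℚ v
        (∑G (λ x → f x * (p₁₁ x * p₂₂ x)) ∷ ∑G (λ x → f x * (p₂₁ x * p₁₂ x)) ∷ ∑G (λ x → f x * 1ℚ) ∷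
         ∑G (λ x → f x * p₁₁ x) ∷ ∑G (λ x → f x * p₁₂ x) ∷ ∑G (λ x → f x * p₂₁ x) ∷ ∑G (λ x → f x * p₂₂ x) ∷ [])
      ∑-value f = trans
        (∑-cong elemsSL λ x → dot-distribˡ (f x) v (Q.monomials qm1 (relative (col₁ x) (col₂ x) m)))
        (∑-dot elemsSL v
          ((λ x → f x * (p₁₁ x * p₂₂ x)) ∷ (λ x → f x * (p₂₁ x * p₁₂ x)) ∷ (λ x → f x * 1ℚ) ∷
           (λ x → f x * p₁₁ x) ∷ (λ x → f x * p₁₂ x) ∷ (λ x → f x * p₂₁ x) ∷ (λ x → f x * p₂₂ x) ∷ []))

      pull : ∀ r {f g : SL₂ → ℚ} → (∀ x → f x ≡ r * g x) → ∀ {s} → ∑G g ≡ s → ∑G f ≡ r * s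
      pull r {f} {g} f≡ e = trans (∑-cong elemsSL f≡) (trans (∑-* elemsSL r g) (cong (r *_) e))

      pair₁₂ : ∑G (λ x → p₁₁ x * p₂₂ x) ≡ qm1
      pair₁₂ = count-transverse (proj₂ m₁≢0)

      pair₂₁ : ∑G (λ x → p₂₁ x * p₁₂ x) ≡ qm1
      pair₂₁ = trans (∑-cong elemsSL λ x → *-comm (p₂₁ x) (p₁₂ x)) (count-transverse (proj₂ m₂≢0))

    sum-all : ∑G (λ x → 1ℚ * translate x) ≡ Q.dot 1ℚ v (Q.total qm1)
    sum-all = trans (∑-value (λ _ → 1ℚ)) (cong (Q.dot 1ℚ v) (cong₇
      (trans (unit _) pair₁₂) (trans (unit _) pair₂₁) (trans (unit _) (count-all (proj₂ m₁≢0)))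
      (trans (unit p₁₁) (count-col₁ (proj₂ m₁≢0))) (trans (unit p₁₂) (count-col₁ (proj₂ m₂≢0)))
      (trans (unit p₂₁) (count-col₂ (proj₂ m₁≢0))) (trans (unit p₂₂) (count-col₂ (proj₂ m₂≢0)))))
      where
      unit : ∀ (f : SL₂ → ℚ) → ∑G (λ x → 1ℚ * f x) ≡ ∑G f
      unit f = ∑-cong elemsSL λ x → *-identityˡ (f x)

    module _ {u : Vec₂} (u≢0 : Nonzero u) where
      private
        -- This form keeps the condition on w, to be paired with a condition on the other column;
        -- `absorb′` keeps the one on u, for sums over a single column.
        absorb : ∀ {x w} → Nonzero x → Nonzero w → par x u * par x w ≡ par w u * par x w
        absorb {x} {w} x≢0 w≢0 = trans (*-comm (par x u) (par x w)) (par-absorb x≢0 w≢0 u)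

        absorb′ : ∀ {x} → Nonzero x → ∀ w → par x u * par x w ≡ par w u * par x u
        absorb′ {x} x≢0 w = trans (par-absorb x≢0 u≢0 w) (cong (_* par x u) (par-sym u w))

        on-left : ∀ f r p s → f * p ≡ r * p → f * (p * s) ≡ r * (p * s)
        on-left f r p s e = trans (sym (*-assoc f p s)) (trans (cong (_* s) e) (*-assoc r p s))

        on-right : ∀ f r p s → f * p ≡ r * p → f * (s * p) ≡ r * (s * p)
        on-right f r p s e = trans (cong (f *_) (*-comm s p))
          (trans (on-left f r p s e) (cong (r *_) (*-comm p s)))

        a₁ : ∀ x → par (col₁ x) u * p₁₁ x ≡ par m₁ u * p₁₁ x
        a₁ x = absorb (col₁-nonzero x) m₁≢0
        a₂ : ∀ x → par (col₁ x) u * p₁₂ x ≡ par m₂ u * p₁₂ x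
        a₂ x = absorb (col₁-nonzero x) m₂≢0
        b₁ : ∀ x → par (col₂ x) u * p₂₁ x ≡ par m₁ u * p₂₁ x
        b₁ x = absorb (col₂-nonzero x) m₁≢0
        b₂ : ∀ x → par (col₂ x) u * p₂₂ x ≡ par m₂ u * p₂₂ x
        b₂ x = absorb (col₂-nonzero x) m₂≢0

      -- A second condition on x₁ is absorbed into one on u and m, which leaves the sum; a condition
      -- on x₂ leaves the pair count of `count-pair`.
      sum-col₁ : ∑G (λ x → par (col₁ x) u * translate x) ≡ Q.dot 1ℚ v (Q.row₁ qm1 (par m₁ u) (par m₂ u))
      sum-col₁ = trans (∑-value (λ x → par (col₁ x) u)) (cong (Q.dot 1ℚ v) (cong₇
        (trans (pull (par m₁ u) (λ x → on-left (par (col₁ x) u) (par m₁ u) (p₁₁ x) (p₂₂ x) (a₁ x)) pair₁₂) (*-comm (par m₁ u) qm1))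
        (trans (pull (par m₂ u) (λ x → on-right (par (col₁ x) u) (par m₂ u) (p₁₂ x) (p₂₁ x) (a₂ x)) pair₂₁) (*-comm (par m₂ u) qm1))
        (trans (∑-cong elemsSL λ x → *-identityʳ (par (col₁ x) u)) (count-col₁ (proj₂ u≢0)))
        (pull (par m₁ u) (λ x → absorb′ (col₁-nonzero x) m₁) (count-col₁ (proj₂ u≢0)))
        (pull (par m₂ u) (λ x → absorb′ (col₁-nonzero x) m₂) (count-col₁ (proj₂ u≢0)))
        (trans (count-pair u≢0 m₁≢0) (cong (λ t → qm1 * (1ℚ - t)) (par-sym u m₁)))
        (trans (count-pair u≢0 m₂≢0) (cong (λ t → qm1 * (1ℚ - t)) (par-sym u m₂)))))

      sum-col₂ : ∑G (λ x → par (col₂ x) u * translate x) ≡ Q.dot 1ℚ v (Q.row₂ qm1 (par m₁ u) (par m₂ u))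
      sum-col₂ = trans (∑-value (λ x → par (col₂ x) u)) (cong (Q.dot 1ℚ v) (cong₇
        (trans (pull (par m₂ u) (λ x → on-right (par (col₂ x) u) (par m₂ u) (p₂₂ x) (p₁₁ x) (b₂ x)) pair₁₂) (*-comm (par m₂ u) qm1))
        (trans (pull (par m₁ u) (λ x → on-left (par (col₂ x) u) (par m₁ u) (p₂₁ x) (p₁₂ x) (b₁ x)) pair₂₁) (*-comm (par m₁ u) qm1))
        (trans (∑-cong elemsSL λ x → *-identityʳ (par (col₂ x) u)) (count-col₂ (proj₂ u≢0)))
        (trans (∑-cong elemsSL λ x → *-comm (par (col₂ x) u) (p₁₁ x)) (count-pair m₁≢0 u≢0))
        (trans (∑-cong elemsSL λ x → *-comm (par (col₂ x) u) (p₁₂ x)) (count-pair m₂≢0 u≢0))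
        (pull (par m₁ u) (λ x → absorb′ (col₂-nonzero x) m₁) (count-col₂ (proj₂ u≢0)))
        (pull (par m₂ u) (λ x → absorb′ (col₂-nonzero x) m₂) (count-col₂ (proj₂ u≢0)))))

    -- The translate depends only on the column directions of x, hence is constant on the n matrices
    -- counted here.
    sum-pair : ∀ {u₁ u₂} → u₁ ∧ u₂ ≢ 0# →
      ∑G (λ x → par (col₁ x) u₁ * par (col₂ x) u₂ * translate x) ≡ qm1 * Q.value qm1 v (relative u₁ u₂ m)
    sum-pair {u₁} {u₂} δ≢0 = trans (pull (Q.value qm1 v (relative u₁ u₂ m))
        (λ x → constant x (col₁ x ∧ u₁ ≟ 0#) (col₂ x ∧ u₂ ≟ 0#)) (count-transverse δ≢0)) (*-comm _ qm1)
      where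
      r : ℚ
      r = Q.value qm1 v (relative u₁ u₂ m)
      constant : ∀ x (d₁ : Dec (col₁ x ∧ u₁ ≡ 0#)) (d₂ : Dec (col₂ x ∧ u₂ ≡ 0#)) →
        indicator d₁ * indicator d₂ * translate x ≡ r * (indicator d₁ * indicator d₂)
      constant x (yes e₁) (yes e₂) = trans (*-comm 1ℚ (translate x)) (cong (λ p → Q.value qm1 v p * 1ℚ)
        (point-≡ (par-subst (col₁-nonzero x) (u₂ , δ≢0) e₁ m₁) (par-subst (col₁-nonzero x) (u₂ , δ≢0) e₁ m₂)
          (par-subst (col₂-nonzero x) u₂≢0 e₂ m₁) (par-subst (col₂-nonzero x) u₂≢0 e₂ m₂)))
        where
        u₂≢0 : Nonzero u₂
        u₂≢0 = u₁ , λ e → δ≢0 (∧-sym {u₂} {u₁} e)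
      constant x (yes _) (no _) = trans (*-zeroˡ (translate x)) (sym (*-zeroʳ r))
      constant x (no _)  d₂     = trans (cong (_* translate x) (*-zeroˡ (indicator d₂)))
        (trans (*-zeroˡ (translate x)) (sym (trans (cong (r *_) (*-zeroˡ (indicator d₂))) (*-zeroʳ r))))

  Φ-⋆ : ∀ u v m → (Φ u ⋆ Φ v) m ≡ Φ (Q.mulV qm1 u v) m
  Φ-⋆ u v m = begin
    (Φ u ⋆ Φ v) m
      ≡⟨ ⋆-∑G (Φ u) (Φ v) m ⟩
    ∑G (λ x → Φ u x * Φ v (x ⁻¹∙ m))
      ≡⟨ ∑-cong elemsSL (λ x → trans (cong (λ p → Φ u x * Q.value qm1 v p) (position-⁻¹∙ x m))
           (dot-distribʳ u (Q.monomials qm1 (position x)) (t x))) ⟩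
    ∑G (λ x → Q.dot 1ℚ u (Vec.map (_* t x) (Q.monomials qm1 (position x))))
      ≡⟨ ∑-dot elemsSL u
           ((λ x → par (col₁ x) e₁ * par (col₂ x) e₂ * t x) ∷ (λ x → par (col₁ x) e₂ * par (col₂ x) e₁ * t x) ∷
            (λ x → 1ℚ * t x) ∷ (λ x → par (col₁ x) e₁ * t x) ∷ (λ x → par (col₂ x) e₁ * t x) ∷
            (λ x → par (col₁ x) e₂ * t x) ∷ (λ x → par (col₂ x) e₂ * t x) ∷ []) ⟩
    Q.dot 1ℚ u _
      ≡⟨ cong (Q.dot 1ℚ u) (cong₇
           (trans (sum-pair v m e₁∧e₂≢0) (cong (λ p → qm1 * Q.value qm1 v p) (relative-e₁-e₂ m)))
           (trans (sum-pair v m e₂∧e₁≢0) (cong (λ p → qm1 * Q.value qm1 v p) (relative-e₂-e₁ m)))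
           (sum-all v m)
           (sum-col₁ v m (e₂ , e₁∧e₂≢0)) (sum-col₂ v m (e₂ , e₁∧e₂≢0))
           (sum-col₁ v m (e₁ , e₂∧e₁≢0)) (sum-col₂ v m (e₁ , e₂∧e₁≢0))) ⟩
    Q.dot qm1 u (Q.convolved qm1 v (position m))
      ≡⟨ value-mulV qm1 u v (position m) ⟩
    Φ (Q.mulV qm1 u v) m ∎
    where
    t : SL₂ → ℚ
    t x = Q.value qm1 v (relative (col₁ x) (col₂ x) m)

  -- Zero patterns and the isomorphism

  unit : Fin 7 → Fin 7 → ℚ
  unit i j = indicator (j ≟ᶠ i)

  -- Equality of vectors instead of pointwise equality: once the four zero tests are decided, both
  -- sides compute and `refl` settles each class.
  HasPattern : SL₂ → Fin 7 → Set
  HasPattern x i = (tabulate (λ j → basis j x) ≡ tabulate (unit i)) × (zeroPattern x ≡ Q.pattern₇ qm1 i)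

  det-degenerate : ∀ {a b c d} → a · d ≡ 0# → b · c ≡ 0# → a · d ⊕ ⊝ (b · c) ≢ 1#
  det-degenerate ad bc e = 0≢1 (trans (sym (solveF 0 (conF (ℤ.+ 0) ⊞ ⊟ (conF (ℤ.+ 0)) ≔ conF (ℤ.+ 0)) refl))
    (trans (sym (cong₂ (λ x y → x ⊕ ⊝ y) ad bc)) e))

  annihilateˡ : ∀ {x y} → x ≡ 0# → x · y ≡ 0#
  annihilateˡ {y = y} e = trans (cong (_· y) e) (zeroˡ y)

  annihilateʳ : ∀ {x y} → y ≡ 0# → x · y ≡ 0#
  annihilateʳ {x} e = trans (cong (x ·_) e) (zeroʳ x)

  classify : ∀ x → Σ (Fin 7) (HasPattern x)
  classify x@((a , b , c , d) , p) with a ≟ 0# | b ≟ 0# | c ≟ 0# | d ≟ 0#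
  ... | no _  | yes _ | yes _ | no _  = 0F , refl , refl
  ... | yes _ | no _  | no _  | yes _ = 1F , refl , refl
  ... | no _  | no _  | no _  | no _  = 2F , refl , refl
  ... | no _  | no _  | yes _ | no _  = 3F , refl , refl
  ... | no _  | yes _ | no _  | no _  = 4F , refl , refl
  ... | no _  | no _  | no _  | yes _ = 5F , refl , refl
  ... | yes _ | no _  | no _  | no _  = 6F , refl , refl
  -- The other nine of the sixteen patterns are those with ad = bc = 0, where the determinant would
  -- be 0.
  ... | yes a≡0 | yes b≡0 | _ | _     = contradiction p (det-degenerate (annihilateˡ a≡0) (annihilateˡ b≡0))
  ... | yes a≡0 | no _ | yes c≡0 | _  = contradiction p (det-degenerate (annihilateˡ a≡0) (annihilateʳ c≡0))
  ... | no _ | yes b≡0 | _ | yes d≡0  = contradiction p (det-degenerate (annihilateʳ d≡0) (annihilateˡ b≡0))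
  ... | no _ | no _ | yes c≡0 | yes d≡0 = contradiction p (det-degenerate (annihilateʳ d≡0) (annihilateʳ c≡0))

  class : SL₂ → Fin 7
  class x = proj₁ (classify x)

  basis-class : ∀ x j → basis j x ≡ unit (class x) j
  basis-class x j = trans (sym (lookup∘tabulate (λ j → basis j x) j))
    (trans (cong (λ b → lookup b j) (proj₁ (proj₂ (classify x)))) (lookup∘tabulate (unit (class x)) j))

  position-class : ∀ x → position x ≡ Q.pattern₇ qm1 (class x)
  position-class x = trans (position≡zeroPattern x) (proj₂ (proj₂ (classify x)))

  comb-class : ∀ c x → comb c x ≡ c (class x)
  comb-class c x = trans (sumℚ-map (λ j → c j * basis j x) (allFin 7))
    (trans (∑-tabulate-at (λ j → j) (class x) (λ j → c j * basis j x) off)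
      (trans (cong (c (class x) *_) (trans (basis-class x (class x)) (indicator-yes (class x ≟ᶠ class x) refl)))
        (*-identityʳ (c (class x)))))
    where
    off : ∀ j → j ≢ class x → c j * basis j x ≡ 0ℚ
    off j j≢ = trans (cong (c j *_) (trans (basis-class x j) (indicator-no (j ≟ᶠ class x) j≢))) (*-zeroʳ (c j))

  Φ-comb : ∀ v x → comb (λ i → Q.value qm1 v (Q.pattern₇ qm1 i)) x ≡ Φ v x
  Φ-comb v x = trans (comb-class (λ i → Q.value qm1 v (Q.pattern₇ qm1 i)) x) (cong (Q.value qm1 v) (sym (position-class x)))

  Φ-interpolate : ∀ c x → Φ (Q.interpolate qm1 c) x ≡ comb c x
  Φ-interpolate c x = trans (sym (Φ-comb (Q.interpolate qm1 c) x))
    (trans (comb-class (λ i → Q.value qm1 (Q.interpolate qm1 c) (Q.pattern₇ qm1 i)) x) (trans (value-interpolate qm1 c (class x)) (sym (comb-class c x))))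

  A-coordinates : Vec ℚ 7
  A-coordinates = 1ℚ ∷ 0ℚ ∷ 0ℚ ∷ 0ℚ ∷ 0ℚ ∷ 0ℚ ∷ 0ℚ ∷ []

  Φ-A : ∀ x → Φ A-coordinates x ≡ A x
  Φ-A x = trans (cong (Q.value qm1 A-coordinates) (position-class x))
    (trans (values (class x)) (sym (basis-class x 0F)))
    where
    values : ∀ i → Q.value qm1 A-coordinates (Q.pattern₇ qm1 i) ≡ unit i 0F
    values = λ { 0F → refl ; 1F → refl ; 2F → refl ; 3F → refl ; 4F → refl ; 5F → refl ; 6F → refl }

  ⊝1≢0 : ⊝ 1# ≢ 0#
  ⊝1≢0 e = 0≢1 (sym (trans (solveF 0 (conF (ℤ.+ 1) ≔ ⊟ (⊟ (conF (ℤ.+ 1)))) refl) (⊝-zero e)))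

  avoid : ∀ {p q r : Carrier} → p ≢ q → p ≢ r → q ≢ r → ∀ y z → Σ Carrier λ t → (t ≢ y) × (t ≢ z)
  avoid {p} {q} {r} p≢q p≢r q≢r y z with p ≟ y | p ≟ z | q ≟ y | q ≟ z
  ... | no p≢y   | no p≢z   | _        | _        = p , p≢y , p≢z
  ... | yes refl | _        | _        | no q≢z   = q , (λ e → p≢q (sym e)) , q≢z
  ... | yes refl | _        | _        | yes refl = r , (λ e → p≢r (sym e)) , (λ e → q≢r (sym e))
  ... | no _     | yes refl | no q≢y   | _        = q , q≢y , (λ e → p≢q (sym e))
  ... | no _     | yes refl | yes refl | _        = r , (λ e → q≢r (sym e)) , (λ e → p≢r (sym e))

  module _ (2<size : 2 < size) where
    -- The class C is empty when q = 2; a unit t ≠ −1 provides the element (1+t t; 1 1) of it.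
    unit-≢-⊝1 : Σ Carrier λ t → (t ≢ 0#) × (t ≢ ⊝ 1#)
    unit-≢-⊝1 = avoid (distinct {0F} {1F} λ ()) (distinct {0F} {2F} λ ()) (distinct {1F} {2F} λ ()) 0# (⊝ 1#)
      where
      element : Fin 3 → Carrier
      element i = from (inject≤ i 2<size)
      distinct : ∀ {i j} → i ≢ j → element i ≢ element j
      distinct {i} {j} i≢j e = i≢j (inject≤-injective 2<size 2<size i j
        (trans (sym (strictlyInverseˡ _)) (trans (cong to e) (strictlyInverseˡ _))))

    representative : ∀ i → Σ SL₂ λ x → position x ≡ Q.pattern₇ qm1 i
    representative i = let x , e = go i in x , trans (position≡zeroPattern x) e
      where
      nz : ∀ {x} → x ≢ 0# → indicator (x ≟ 0#) ≡ 0ℚ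
      nz {x} = indicator-no (x ≟ 0#)
      z : indicator (0# ≟ 0#) ≡ 1ℚ
      z = indicator-yes (0# ≟ 0#) refl
      t : Carrier
      t = proj₁ unit-≢-⊝1
      1+t≢0 : 1# ⊕ t ≢ 0#
      1+t≢0 e = proj₂ (proj₂ unit-≢-⊝1) (trans (solveF 1 (λ t → t ≔ conF (ℤ.+ 1) ⊞ t ⊞ ⊟ (conF (ℤ.+ 1))) refl t)
        (trans (cong (_⊕ ⊝ 1#) e) (⊕-identityˡ (⊝ 1#))))
      o l : ∀ {m} → 𝔽.Polynomial m
      o = conF (ℤ.+ 0)
      l = conF (ℤ.+ 1)
      go : ∀ i → Σ SL₂ λ x → zeroPattern x ≡ Q.pattern₇ qm1 i
      go 0F = ((1# , 0# , 0# , 1#) , solveF 0 (l ⊡ l ⊞ ⊟ (o ⊡ o) ≔ l) refl) , point-≡ z (nz 1≢0) (nz 1≢0) z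
      go 1F = ((0# , 1# , ⊝ 1# , 0#) , solveF 0 (o ⊡ o ⊞ ⊟ (l ⊡ ⊟ l) ≔ l) refl) , point-≡ (nz ⊝1≢0) z z (nz 1≢0)
      go 2F = ((1# ⊕ t , t , 1# , 1#) , solveF 1 (λ t → (l ⊞ t) ⊡ l ⊞ ⊟ (t ⊡ l) ≔ l) refl t) ,
        point-≡ (nz 1≢0) (nz 1≢0) (nz 1+t≢0) (nz (proj₁ (proj₂ unit-≢-⊝1)))
      go 3F = ((1# , 1# , 0# , 1#) , solveF 0 (l ⊡ l ⊞ ⊟ (l ⊡ o) ≔ l) refl) , point-≡ z (nz 1≢0) (nz 1≢0) (nz 1≢0)
      go 4F = ((1# , 0# , 1# , 1#) , solveF 0 (l ⊡ l ⊞ ⊟ (o ⊡ l) ≔ l) refl) , point-≡ (nz 1≢0) (nz 1≢0) (nz 1≢0) z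
      go 5F = ((1# , 1# , ⊝ 1# , 0#) , solveF 0 (l ⊡ o ⊞ ⊟ (l ⊡ ⊟ l) ≔ l) refl) , point-≡ (nz ⊝1≢0) z (nz 1≢0) (nz 1≢0)
      go 6F = ((0# , 1# , ⊝ 1# , 1#) , solveF 0 (o ⊡ l ⊞ ⊟ (l ⊡ ⊟ l) ≔ l) refl) , point-≡ (nz ⊝1≢0) (nz 1≢0) z (nz 1≢0)

    -- Every class has a representative, so the function determines the seven class values, and
    -- interpolation recovers the coordinates from them.
    Φ-injective : ∀ u v → (∀ x → Φ u x ≡ Φ v x) → u ≡ v
    Φ-injective u v e = trans (sym (value-recover qm1 u)) (trans (interpolate-cong qm1 agree) (value-recover qm1 v))
      where
      agree : ∀ i → Q.value qm1 u (Q.pattern₇ qm1 i) ≡ Q.value qm1 v (Q.pattern₇ qm1 i)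
      agree i with representative i
      ... | x , at = trans (cong (Q.value qm1 u) (sym at)) (trans (e x) (cong (Q.value qm1 v) at))

    private
      n≡ : Σ ℕ λ m → qm1 ≡ ℤ.+ suc m / 1
      n≡ = split 2<size
        where
        split : ∀ {s} → 2 < s → Σ ℕ λ m → ℤ.+ (s ∸ 1) / 1 ≡ ℤ.+ suc m / 1
        -- Here q = m + 2 and n = m + 1, so n, q and q + 1 are successors and thus invertible in ℚ.
        split (s≤s (s≤s {n = m} _)) = m , refl

      inverse-at : ∀ {r} m → r ≡ ℤ.+ suc m / 1 → Σ ℚ λ i → r * i ≡ 1ℚ
      inverse-at m refl = /1-inverse m

      next : ∀ {r} m → r ≡ ℤ.+ m / 1 → r + 1ℚ ≡ ℤ.+ suc m / 1
      next m e = trans (cong (_+ 1ℚ) e) (trans (solve 1 (λ r → r :+ con (ℤ.+ 1) := con (ℤ.+ 1) :+ r) refl (ℤ.+ m / 1))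
        (1+m/1≡[1+m]/1 m))

      m : ℕ
      m = proj₁ n≡

      n⁻¹ : Σ ℚ λ i → qm1 * i ≡ 1ℚ
      n⁻¹ = inverse-at m (proj₂ n≡)

      q⁻¹ : Σ ℚ λ i → (qm1 + 1ℚ) * i ≡ 1ℚ
      q⁻¹ = inverse-at (suc m) (next (suc m) (proj₂ n≡))

      [q+1]⁻¹ : Σ ℚ λ i → (qm1 + 1ℚ + 1ℚ) * i ≡ 1ℚ
      [q+1]⁻¹ = inverse-at (suc (suc m)) (next (suc (suc m)) (next (suc m) (proj₂ n≡)))

      i j k : ℚ
      i = proj₁ n⁻¹
      j = proj₁ q⁻¹
      k = proj₁ [q+1]⁻¹

    χ χ⁻¹ : _
    χ = Q.χ qm1
    χ⁻¹ = Q.χ⁻¹ qm1 ½ i j k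

    χ-χ⁻¹ : ∀ t → χ (χ⁻¹ t) ≡ t
    χ-χ⁻¹ = χ∘χ⁻¹ qm1 ½ i j k (proj₂ n⁻¹) (proj₂ q⁻¹) (proj₂ [q+1]⁻¹) refl

    χ⁻¹-χ : ∀ v → χ⁻¹ (χ v) ≡ v
    χ⁻¹-χ = χ⁻¹∘χ qm1 ½ i j k (proj₂ n⁻¹) (proj₂ q⁻¹) (proj₂ [q+1]⁻¹) refl

    χ⁻¹-*T : ∀ s t → χ⁻¹ (s *T t) ≡ Q.mulV qm1 (χ⁻¹ s) (χ⁻¹ t)
    χ⁻¹-*T s t = begin
      χ⁻¹ (s *T t)                          ≡⟨ cong₂ (λ s t → χ⁻¹ (s *T t)) (χ-χ⁻¹ s) (χ-χ⁻¹ t) ⟨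
      χ⁻¹ (χ (χ⁻¹ s) *T χ (χ⁻¹ t))          ≡⟨ cong χ⁻¹ (χ-mulV qm1 (χ⁻¹ s) (χ⁻¹ t)) ⟨
      χ⁻¹ (χ (Q.mulV qm1 (χ⁻¹ s) (χ⁻¹ t)))  ≡⟨ χ⁻¹-χ (Q.mulV qm1 (χ⁻¹ s) (χ⁻¹ t)) ⟩
      Q.mulV qm1 (χ⁻¹ s) (χ⁻¹ t)            ∎

    ψ : T → QG
    ψ t = Φ (χ⁻¹ t)

    -- A is n times the identity element, and this is the shape in which `unital` asks for it.
    χ-A : qm1 •T 1T ≡ χ A-coordinates
    χ-A = congT
      (solve 1 (λ n → let q = n :+ l in n :* l := n :* (l :+ o) :+ n :* q :* ((q :+ l) :* o :+ (o :+ o :+ o :+ o))) refl qm1)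
      (solve 1 (λ n → n :* l := n :* (l :+ o)) refl qm1)
      (solve 1 (λ n → n :* l := n :* (l :- o)) refl qm1)
      (diagonal 1ℚ) (diagonal 0ℚ) (diagonal 0ℚ) (diagonal 1ℚ)
      where
      o l : ∀ {m} → ℚ-Solver.Polynomial m
      o = con (ℤ.+ 0)
      l = con (ℤ.+ 1)
      diagonal : ∀ a → qm1 * a ≡ qm1 * (a + ((qm1 + 1ℚ) * 0ℚ - 0ℚ))
      diagonal a = solve 2 (λ n a → n :* a := n :* (a :+ ((n :+ l) :* o :- o))) refl qm1 a

    ψ-iso : IsoToSC F ψ
    ψ-iso = record
      { additive       = λ s t x → χ⁻¹-+-value qm1 ½ i j k s t (position x)
      ; homogeneous    = λ r t x → χ⁻¹-•-value qm1 ½ i j k r t (position x)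
      ; multiplicative = λ s t x → trans (cong (λ v → Φ v x) (χ⁻¹-*T s t)) (sym (Φ-⋆ (χ⁻¹ s) (χ⁻¹ t) x))
      ; unital         = λ x → trans (sym (χ⁻¹-•-value qm1 ½ i j k qm1 1T (position x)))
          (trans (cong (λ t → Φ (χ⁻¹ t) x) χ-A) (trans (cong (λ v → Φ v x) (χ⁻¹-χ A-coordinates)) (Φ-A x)))
      ; injective      = λ s t e → trans (sym (χ-χ⁻¹ s)) (trans (cong χ (Φ-injective (χ⁻¹ s) (χ⁻¹ t) e)) (χ-χ⁻¹ t))
      ; into𝒮𝒞         = λ t → (λ i → Q.value qm1 (χ⁻¹ t) (Q.pattern₇ qm1 i)) , Φ-comb (χ⁻¹ t)
      ; onto𝒮𝒞         = λ c → χ (Q.interpolate qm1 c) ,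
          λ x → trans (cong (λ v → Φ v x) (χ⁻¹-χ (Q.interpolate qm1 c))) (Φ-interpolate c x)
      }

theorem3p1 : (F : FiniteField) → 2 < FiniteField.size F →
    Σ (T → SupportClasses.QG F) (λ ψ → IsoToSC F ψ)
theorem3p1 F 2<size = SL₂Algebra.ψ F 2<size , SL₂Algebra.ψ-iso F 2<size
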